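{- Let $d\ge46$. Let $h_1<\dots<h_k$ and $h'_1<\dots<h'_{k'}$ be finite strictly increasing sequences of positive integers such that $h_1\ge7$, $h'_1\ge7$, $h_k=d+k+1$, $h'_{k'}=d+k'+1$, and $h_{i+1}-h_i\ge4$, $h'_{i+1}-h'_i\ge4$ for all relevant $i$. Then the lattices $L_d(h_1,\dots,h_k)$ and $L_d(h'_1,\dots,h'_{k'})$ are isometric if and only if $k=k'$ and $h_i=h'_i$ for all $i$.
   Context: For a strictly increasing (finite or infinite, possibly empty) sequence of positive integers $h_1<h_2<\dots$ (called holes) and an integer $d\ge1$, let $s_1<s_2<\dots<s_{d+2}$ be the $d+2$ smallest elements of $\{1,2,3,\dots\}\setminus\{h_1,h_2,\dots\}$, and define $L_d(h_1,h_2,\dots)=\{x\in\mathbb Z^{d+2}:\ \sum_{i=1}^{d+2}x_i=0,\ \sum_{i=1}^{d+2}s_ix_i=0\}$ with the standard inner product of $\mathbb R^{d+2}$; it is an even integral lattice of rank $d$. Isomorphism of lattices means isometry. -}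

module Defs where

open import Level using (0ℓ)
open import Algebra.Bundles using (AbelianGroup; RawGroup)
open import Algebra.Morphism.Structures using (module GroupMorphisms)
import Algebra.Construct.Pointwise as Pointwise
import Algebra.Morphism.GroupMonomorphism as GroupMonomorphism
import Algebra.Properties.Semiring.Sum as Sum
open import Data.Bool.Base using (if_then_else_)
open import Data.Fin.Base using (Fin; toℕ)
import Data.Fin.Base as Fin
import Data.Fin.Properties as Fin
open import Data.Integer.Base using (ℤ; +_; 0ℤ; -1ℤ)
import Data.Integer.Base as ℤ
import Data.Integer.Properties as ℤ
open import Data.Nat.Base using (ℕ; zero; suc; _+_; _≤_; _<_; z≤n; s≤s)
import Data.Nat.Properties as ℕ
open import Data.Product.Base using (Σ; ∃-syntax; _×_; _,_; proj₁; proj₂)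
open import Data.Vec.Functional using (Vector)
open import Relation.Binary.PropositionalEquality
open import Relation.Nullary using (¬_; Dec; yes; no; does; contradiction)

module ℤ-Sum = Sum ℤ.+-*-semiring
open ℤ-Sum using (sum-syntax)

ℤ^ : ℕ → AbelianGroup 0ℓ 0ℓ
ℤ^ n = Pointwise.abelianGroup (Fin n) ℤ.+-0-abelianGroup

infix 7 _·_

_·_ : ∀ {n} → Vector ℤ n → Vector ℤ n → ℤ
_·_ {n} x y = ∑[ i < n ] (x i ℤ.* y i)

-- Subgroups of ℤⁿ.  Vectors are compared pointwise, so membership is required
-- to respect pointwise equality.
record IntegerLattice (n : ℕ) : Set₁ where
  open AbelianGroup (ℤ^ n) using (_≈_; _∙_; ε; _⁻¹)
  field
    Member    : Vector ℤ n → Set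
    ≈-member  : ∀ {x y} → x ≈ y → Member x → Member y
    ε-member  : Member ε
    ∙-member  : ∀ {x y} → Member x → Member y → Member (x ∙ y)
    ⁻¹-member : ∀ {x} → Member x → Member (x ⁻¹)

  rawGroup : RawGroup 0ℓ 0ℓ
  rawGroup = record
    { Carrier = Σ (Vector ℤ n) Member
    ; _≈_     = λ x y → proj₁ x ≈ proj₁ y
    ; _∙_     = λ x y → proj₁ x ∙ proj₁ y , ∙-member (proj₂ x) (proj₂ y)
    ; ε       = ε , ε-member
    ; _⁻¹     = λ x → proj₁ x ⁻¹ , ⁻¹-member (proj₂ x)
    }

  open GroupMorphisms rawGroup (AbelianGroup.rawGroup (ℤ^ n))

  inclusion : IsGroupMonomorphism proj₁
  inclusion = record
    { isGroupHomomorphism = record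
      { isMonoidHomomorphism = record
        { isMagmaHomomorphism = record
          { isRelHomomorphism = record { cong = λ eq → eq }
          ; homo = λ _ _ _ → refl
          }
        ; ε-homo = λ _ → refl
        }
      ; ⁻¹-homo = λ _ _ → refl
      }
    ; injective = λ eq → eq
    }

  abelianGroup : AbelianGroup 0ℓ 0ℓ
  abelianGroup = record
    { isAbelianGroup = GroupMonomorphism.isAbelianGroup inclusion
                         (AbelianGroup.isAbelianGroup (ℤ^ n))
    }

record Isometric {m n} (Λ : IntegerLattice m) (Λ′ : IntegerLattice n) : Set where
  private
    module Λ  = AbelianGroup (IntegerLattice.abelianGroup Λ)
    module Λ′ = AbelianGroup (IntegerLattice.abelianGroup Λ′)
  open GroupMorphisms Λ.rawGroup Λ′.rawGroup
  field
    to            : Λ.Carrier → Λ′.Carrier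
    isIsomorphism : IsGroupIsomorphism to
    preserves-·   : ∀ x y → proj₁ (to x) · proj₁ (to y) ≡ proj₁ x · proj₁ y

record IsHoleSequence {k} (h : Vector ℕ k) : Set where
  field
    positive           : ∀ i → 1 ≤ h i
    strictlyIncreasing : ∀ i j → i Fin.< j → h i < h j

IsHole : ∀ {k} → Vector ℕ k → ℕ → Set
IsHole h m = ∃[ i ] h i ≡ m

isHole? : ∀ {k} (h : Vector ℕ k) m → Dec (IsHole h m)
isHole? h m = Fin.any? (λ i → h i ℕ.≟ m)

skipHoles : ∀ {k} → Vector ℕ k → ℕ → ℕ → ℕ
skipHoles h zero       m = m
skipHoles h (suc fuel) m =
  if does (isHole? h m) then skipHoles h fuel (suc m) else m

-- The least non-hole ≥ m; at most k consecutive integers can be holes.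
nextNonHole : ∀ {k} → Vector ℕ k → ℕ → ℕ
nextNonHole {k} h m = skipHoles h k m

-- Indexed from 0: nonHole h i is s_{i+1}.
nonHole : ∀ {k} → Vector ℕ k → ℕ → ℕ
nonHole h zero    = nextNonHole h 1
nonHole h (suc i) = nextNonHole h (suc (nonHole h i))

record AreSmallestNonHoles {k n} (h : Vector ℕ k) (s : Vector ℕ n) : Set where
  field
    strictlyIncreasing : ∀ i j → i Fin.< j → s i < s j
    positive           : ∀ i → 1 ≤ s i
    nonHoles           : ∀ i → ¬ IsHole h (s i)
    smallest           : ∀ i m → 1 ≤ m → ¬ IsHole h m → m ≤ s i → ∃[ j ] s j ≡ m

private
  module _ {k} (h : Vector ℕ k) where

    skip-≥ : ∀ f m → m ≤ skipHoles h f m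
    skip-≥ zero    m = ℕ.≤-refl
    skip-≥ (suc f) m with isHole? h m
    ... | yes _ = ℕ.≤-trans (ℕ.n≤1+n m) (skip-≥ f (suc m))
    ... | no  _ = ℕ.≤-refl

    skip-least : ∀ f m x → m ≤ x → x < skipHoles h f m → IsHole h x
    skip-least zero    m x m≤x x<m = contradiction x<m (ℕ.≤⇒≯ m≤x)
    skip-least (suc f) m x m≤x x<r with isHole? h m
    ... | no  _ = contradiction x<r (ℕ.≤⇒≯ m≤x)
    ... | yes p with m ℕ.≟ x
    ...   | yes refl = p
    ...   | no  m≢x  = skip-least f (suc m) x (ℕ.≤∧≢⇒< m≤x m≢x) x<r

    noRun : ∀ m → ¬ (∀ j → j ≤ k → IsHole h (m + j))
    noRun m run with Fin.pigeonhole (ℕ.n<1+n k) index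
      where
      index : Fin (suc k) → Fin k
      index j = proj₁ (run (toℕ j) (Fin.toℕ≤pred[n] j))
    ... | i , j , i<j , eq = ℕ.<⇒≢ i<j (ℕ.+-cancelˡ-≡ m _ _ (trans
      (sym (proj₂ (run (toℕ i) (Fin.toℕ≤pred[n] i))))
      (trans (cong h eq) (proj₂ (run (toℕ j) (Fin.toℕ≤pred[n] j))))))

    skip-end : ∀ f m → IsHole h (skipHoles h f m) → skipHoles h f m ≡ m + f
    skip-end zero    m p = sym (ℕ.+-identityʳ m)
    skip-end (suc f) m p with isHole? h m
    ... | no ¬p = contradiction p ¬p
    ... | yes _ = trans (skip-end f (suc m) p) (sym (ℕ.+-suc m f))

    next-nonHole : ∀ m → ¬ IsHole h (nextNonHole h m)
    next-nonHole m p = noRun m run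
      where
      end : nextNonHole h m ≡ m + k
      end = skip-end k m p
      run : ∀ j → j ≤ k → IsHole h (m + j)
      run j j≤k with j ℕ.≟ k
      ... | yes refl = subst (IsHole h) end p
      ... | no  j≢k  = skip-least k m (m + j) (ℕ.m≤m+n m j)
        (subst (m + j <_) (sym end) (ℕ.+-monoʳ-< m (ℕ.≤∧≢⇒< j≤k j≢k)))

    nonHole-step : ∀ i → nonHole h i < nonHole h (suc i)
    nonHole-step i = skip-≥ k (suc (nonHole h i))

    nonHole-mono : ∀ i j → i < j → nonHole h i < nonHole h j
    nonHole-mono i (suc j) (s≤s i≤j) with i ℕ.≟ j
    ... | yes refl = nonHole-step i
    ... | no  i≢j  = ℕ.<-trans (nonHole-mono i j (ℕ.≤∧≢⇒< i≤j i≢j)) (nonHole-step j)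

    nonHole-pos : ∀ i → 1 ≤ nonHole h i
    nonHole-pos zero    = skip-≥ k 1
    nonHole-pos (suc i) = ℕ.≤-trans (s≤s z≤n) (nonHole-step i)

    nonHole-∉ : ∀ i → ¬ IsHole h (nonHole h i)
    nonHole-∉ zero    = next-nonHole 1
    nonHole-∉ (suc i) = next-nonHole (suc (nonHole h i))

    nonHole-smallest : ∀ i m → 1 ≤ m → ¬ IsHole h m → m ≤ nonHole h i →
                       ∃[ j ] j ≤ i × nonHole h j ≡ m
    nonHole-smallest i m 1≤m m∉ m≤s with m ℕ.≟ nonHole h i
    ... | yes m≡s = i , ℕ.≤-refl , sym m≡s
    nonHole-smallest zero m 1≤m m∉ m≤s | no m≢s =
      contradiction (skip-least k 1 m 1≤m (ℕ.≤∧≢⇒< m≤s m≢s)) m∉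
    nonHole-smallest (suc i) m 1≤m m∉ m≤s | no m≢s with m ℕ.≤? nonHole h i
    ... | yes m≤s′ = let j , j≤i , eq = nonHole-smallest i m 1≤m m∉ m≤s′
                     in j , ℕ.m≤n⇒m≤1+n j≤i , eq
    ... | no  m≰s′ = contradiction
      (skip-least k (suc (nonHole h i)) m (ℕ.≰⇒> m≰s′) (ℕ.≤∧≢⇒< m≤s m≢s)) m∉

smallestNonHoles : ∀ {k} → Vector ℕ k → ∀ n → Vector ℕ n
smallestNonHoles h n i = nonHole h (toℕ i)

areSmallestNonHoles : ∀ {k} (h : Vector ℕ k) n →
                      AreSmallestNonHoles h (smallestNonHoles h n)
areSmallestNonHoles h n = record
  { strictlyIncreasing = λ i j → nonHole-mono h (toℕ i) (toℕ j)
  ; positive           = λ i → nonHole-pos h (toℕ i)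
  ; nonHoles           = λ i → nonHole-∉ h (toℕ i)
  ; smallest           = λ i m 1≤m m∉ m≤s →
      let j , j≤i , eq = nonHole-smallest h (toℕ i) m 1≤m m∉ m≤s
          j<n = ℕ.≤-<-trans j≤i (Fin.toℕ<n i)
      in Fin.fromℕ< j<n , trans (cong (nonHole h) (Fin.toℕ-fromℕ< j<n)) eq
  }

private
  sum-neg : ∀ {n} (x : Vector ℤ n) → ∑[ i < n ] (ℤ.- x i) ≡ ℤ.- (∑[ i < n ] x i)
  sum-neg x =
    trans (ℤ-Sum.sum-cong-≗ (λ i → sym (ℤ.-1*i≡-i (x i))))
          (trans (sym (ℤ-Sum.*-distribˡ-sum -1ℤ x)) (ℤ.-1*i≡-i (ℤ-Sum.sum x)))

  module _ {n} (w : Vector ℤ n) where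

    ·-cong : ∀ {x y : Vector ℤ n} → (∀ i → x i ≡ y i) → w · x ≡ w · y
    ·-cong x≈y = ℤ-Sum.sum-cong-≗ (λ i → cong (w i ℤ.*_) (x≈y i))

    ·-zero : w · (λ _ → 0ℤ) ≡ 0ℤ
    ·-zero = trans (ℤ-Sum.sum-cong-≗ (λ i → ℤ.*-zeroʳ (w i))) (ℤ-Sum.sum-replicate-zero n)

    ·-+ : ∀ x y → w · (λ i → x i ℤ.+ y i) ≡ w · x ℤ.+ w · y
    ·-+ x y = trans (ℤ-Sum.sum-cong-≗ (λ i → ℤ.*-distribˡ-+ (w i) (x i) (y i)))
                    (ℤ-Sum.∑-distrib-+ (λ i → w i ℤ.* x i) (λ i → w i ℤ.* y i))

    ·-neg : ∀ x → w · (λ i → ℤ.- x i) ≡ ℤ.- (w · x)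
    ·-neg x = trans (ℤ-Sum.sum-cong-≗ (λ i → sym (ℤ.neg-distribʳ-* (w i) (x i))))
                    (sum-neg (λ i → w i ℤ.* x i))

L : ∀ (d : ℕ) {k} → Vector ℕ k → IntegerLattice (d + 2)
L d h = record
  { Member    = λ x → (∑[ i < d + 2 ] x i ≡ 0ℤ) ×
                      (∑[ i < d + 2 ] (+ s i ℤ.* x i) ≡ 0ℤ)
  ; ≈-member  = λ x≈y (p , q) →
      trans (sym (ℤ-Sum.sum-cong-≗ x≈y)) p , trans (sym (·-cong w x≈y)) q
  ; ε-member  = ℤ-Sum.sum-replicate-zero (d + 2) , ·-zero w
  ; ∙-member  = λ {x} {y} (p , q) (p′ , q′) →
      trans (ℤ-Sum.∑-distrib-+ x y) (cong₂ ℤ._+_ p p′) ,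
      trans (·-+ w x y) (cong₂ ℤ._+_ q q′)
  ; ⁻¹-member = λ {x} (p , q) →
      trans (sum-neg x) (cong ℤ.-_ p) , trans (·-neg w x) (cong ℤ.-_ q)
  }
  where
  s : Vector ℕ (d + 2)
  s = smallestNonHoles h (d + 2)
  w : Vector ℤ (d + 2)
  w i = + s i

module Submission where

-- An isometry T : L → L′ is shown to be the restriction of a signed coordinate
-- permutation.  For σ = 49 and σ = 50 the spacing of the holes leaves 13
-- disjoint pairs of indices (a, b) with s_a + s_b = σ.  The vectors e_a + e_b
-- of one σ form a regular simplex whose differences are minimal vectors of L,
-- and a simplex of squared edge 4 with 13 vertices in ℤᴺ has an integral
-- centre, at distance √2 from its vertices.  So T extends
-- isometrically to L + ℤ (e_a + e_b) for both σ, that is to {x : ∑ x even};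
-- the images of the vectors 2 e_i turn out to be even, and T extends to ℤⁿ.
-- A signed permutation carrying L to L′ carries s to an affine image of s′;
-- as both sequences begin with gaps 1 and end with a gap 2, s = s′.

open import Defs
open import Algebra.Bundles using (AbelianGroup)
open import Algebra.Morphism.Structures using (module GroupMorphisms)
open import Data.Fin.Base using (Fin; zero; suc; inject₁; fromℕ; cast)
import Data.Fin.Base as Fin
import Data.Fin.Induction as Fin
import Data.Fin.Properties as Fin
open import Data.Integer.Base using (ℤ; 0ℤ; 1ℤ)
import Data.Integer.Base as ℤ
import Data.Integer.DivMod as ℤ
import Data.Integer.Properties as ℤ
open import Data.Integer.Tactic.RingSolver using (solve-∀)
open import Data.Nat.Base as ℕ using (ℕ; zero; suc; z≤n; s≤s)
import Data.Nat.Properties as ℕ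
open import Data.Product.Base using (Σ; ∃; _×_; _,_; proj₁; proj₂)
open import Data.Sum.Base using (_⊎_; inj₁; inj₂)
open import Data.Vec.Functional using (Vector; _∷_)
open import Function.Base using (_∘_)
open import Function.Bundles using (_⇔_; mk⇔)
open import Function.Definitions using (Injective)
open import Relation.Binary.Definitions using (Tri; tri<; tri≈; tri>)
open import Relation.Binary.PropositionalEquality
open import Relation.Nullary using (¬_; Dec; yes; no; contradiction)
open import Relation.Nullary.Decidable using (True; toWitness; from-yes; from-no; ¬?; _×-dec_)
open import Relation.Unary using (Decidable)

-- Thirteen is both what the argument consumes and what the holes leave. For a minimal vector `x`
-- the numbers `T x · q i - x · p i`, with `p i` the vector of the i-th pair and `q i` its recentred
-- image, do not depend on `i`, because `T` is isometric on the differences `p i - p k`. Bessel's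
-- inequality bounds the sum of the squares of `T x · q i` by 2 * 4, and `x` has only four nonzero
-- coordinates, so it meets at most four of the disjoint pairs; a nonzero constant would need 13 ≤ 8
-- + 4. On the other side, cut 1, ..., 24 into six blocks of four. A block contains at most one hole
-- and at most one reflected hole; the first contains no hole, because holes are at least 7. This
-- leaves 3 + 5 * 2 = 13. The partners run up to 50 - 1 = 49, and `d ≥ 46` with at least one hole
-- places 49 within the range filled by holes and non-holes. Two sums are used because adjoining one
-- pair vector only reaches vectors whose coordinate sum and `s`-weighted sum form a multiple of (2,
-- σ); (2, 49) and (2, 50) together give every pair with even first entry.

module Lattices where

  open import Data.Integer.Base using (+_; +[1+_]; -[1+_]; -_; _-_; _+_; _*_; _≤_; _<_; +≤+; -≤+; +<+)
  open ℤ-Sum using (sum; sum-cong-≗; ∑-distrib-+; ∑-comm; *-distribˡ-sum; *-distribʳ-sum)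

  private variable m n N : ℕ

  -- Integer inequalities, inner products and Bessel's inequality

  0≤i*i : ∀ i → 0ℤ ≤ i * i
  0≤i*i (+ zero) = +≤+ z≤n
  0≤i*i +[1+ n ] = +≤+ z≤n
  0≤i*i -[1+ n ] = +≤+ z≤n

  ≤-by : ∀ {a b} c → 0ℤ ≤ c → b - a ≡ c → a ≤ b
  ≤-by c 0≤c eq = ℤ.0≤i-j⇒j≤i (subst (0ℤ ≤_) (sym eq) 0≤c)

  0≤+ : ∀ {a b} → 0ℤ ≤ a → 0ℤ ≤ b → 0ℤ ≤ a + b
  0≤+ = ℤ.+-mono-≤

  0≤* : ∀ {a b} → 0ℤ ≤ a → 0ℤ ≤ b → 0ℤ ≤ a * b
  0≤* {+ a} {+ b} _ _ = subst (0ℤ ≤_) (ℤ.pos-* a b) (+≤+ z≤n)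

  ≤⇒0≤- : ∀ {a b} → a ≤ b → 0ℤ ≤ b - a
  ≤⇒0≤- = ℤ.i≤j⇒0≤j-i

  cancel-*-≤ : ∀ k {a b} → +[1+ k ] * a ≤ +[1+ k ] * b → a ≤ b
  cancel-*-≤ k {a} {b} = ℤ.*-cancelˡ-≤-pos a b +[1+ k ]

  infixl 6 _⊕_ _⊖_
  infixr 7.5 _⊛_

  _⊕_ _⊖_ : Vector ℤ n → Vector ℤ n → Vector ℤ n
  (x ⊕ y) i = x i + y i
  (x ⊖ y) i = x i - y i

  _⊛_ : ℤ → Vector ℤ n → Vector ℤ n
  (c ⊛ x) i = c * x i

  𝟏 : Vector ℤ n
  𝟏 _ = 1ℤ

  δ : Fin n → Vector ℤ n
  δ zero    zero    = 1ℤ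
  δ zero    (suc _) = 0ℤ
  δ (suc _) zero    = 0ℤ
  δ (suc a) (suc k) = δ a k

  δ-refl : (a : Fin n) → δ a a ≡ 1ℤ
  δ-refl zero    = refl
  δ-refl (suc a) = δ-refl a

  δ-≢ : {a k : Fin n} → a ≢ k → δ a k ≡ 0ℤ
  δ-≢ {a = zero}  {zero}  a≢k = contradiction refl a≢k
  δ-≢ {a = zero}  {suc k} a≢k = refl
  δ-≢ {a = suc a} {zero}  a≢k = refl
  δ-≢ {a = suc a} {suc k} a≢k = δ-≢ (a≢k ∘ cong suc)

  0≤δ : (a k : Fin n) → 0ℤ ≤ δ a k
  0≤δ zero    zero    = +≤+ z≤n
  0≤δ zero    (suc k) = +≤+ z≤n
  0≤δ (suc a) zero    = +≤+ z≤n
  0≤δ (suc a) (suc k) = 0≤δ a k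

  sum-zero : {f : Vector ℤ n} → (∀ i → f i ≡ 0ℤ) → sum f ≡ 0ℤ
  sum-zero {n} f≗0 = trans (sum-cong-≗ f≗0) (ℤ-Sum.sum-replicate-zero n)

  sum-const : ∀ n c → sum {n} (λ _ → c) ≡ + n * c
  sum-const zero    c = sym (ℤ.*-zeroˡ c)
  sum-const (suc n) c = trans (cong (λ z → c + z) (sum-const n c)) (sym (ℤ.suc-* (+ n) c))

  sum-mono : {f g : Vector ℤ n} → (∀ i → f i ≤ g i) → sum f ≤ sum g
  sum-mono {zero}  f≤g = ℤ.≤-refl
  sum-mono {suc n} f≤g = ℤ.+-mono-≤ (f≤g zero) (sum-mono (f≤g ∘ suc))

  0≤sum : {f : Vector ℤ n} → (∀ i → 0ℤ ≤ f i) → 0ℤ ≤ sum f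
  0≤sum {zero}  0≤f = ℤ.≤-refl
  0≤sum {suc n} 0≤f = 0≤+ (0≤f zero) (0≤sum (0≤f ∘ suc))

  term≤sum : {f : Vector ℤ n} → (∀ i → 0ℤ ≤ f i) → ∀ i → f i ≤ sum f
  term≤sum {suc n} {f} 0≤f zero =
    subst (_≤ sum f) (ℤ.+-identityʳ _) (ℤ.+-monoʳ-≤ (f zero) (0≤sum (0≤f ∘ suc)))
  term≤sum {suc n} {f} 0≤f (suc i) =
    subst (_≤ sum f) (ℤ.+-identityˡ _) (ℤ.+-mono-≤ (0≤f zero) (term≤sum (0≤f ∘ suc) i))

  ·-cong : {x x′ y y′ : Vector ℤ n} → x ≗ x′ → y ≗ y′ → x · y ≡ x′ · y′
  ·-cong x≗x′ y≗y′ = sum-cong-≗ (λ i → cong₂ _*_ (x≗x′ i) (y≗y′ i))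

  ·-comm : (x y : Vector ℤ n) → x · y ≡ y · x
  ·-comm x y = sum-cong-≗ (λ i → ℤ.*-comm (x i) (y i))

  ·-⊕ˡ : (x y z : Vector ℤ n) → (x ⊕ y) · z ≡ x · z + y · z
  ·-⊕ˡ x y z = trans (sum-cong-≗ (λ i → ℤ.*-distribʳ-+ (z i) (x i) (y i)))
      (∑-distrib-+ (λ i → x i * z i) (λ i → y i * z i))

  ·-⊛ˡ : ∀ c (x z : Vector ℤ n) → (c ⊛ x) · z ≡ c * (x · z)
  ·-⊛ˡ c x z = trans (sum-cong-≗ (λ i → ℤ.*-assoc c (x i) (z i))) (sym (*-distribˡ-sum c (λ i → x i * z i)))

  ·-⊖ˡ : (x y z : Vector ℤ n) → (x ⊖ y) · z ≡ x · z - y · z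
  ·-⊖ˡ x y z = begin
    (x ⊖ y) · z               ≡⟨ ·-cong {y = z} (λ i → minus (x i) (y i)) (λ _ → refl) ⟩
    (x ⊕ (- 1ℤ) ⊛ y) · z      ≡⟨ ·-⊕ˡ x ((- 1ℤ) ⊛ y) z ⟩
    x · z + ((- 1ℤ) ⊛ y) · z  ≡⟨ cong (λ a → x · z + a) (·-⊛ˡ (- 1ℤ) y z) ⟩
    x · z + - 1ℤ * (y · z)    ≡⟨ sym (minus (x · z) (y · z)) ⟩
    x · z - y · z             ∎
    where
    open ≡-Reasoning
    minus : ∀ a b → a - b ≡ a + - 1ℤ * b
    minus = solve-∀

  ·-⊕ʳ : (z x y : Vector ℤ n) → z · (x ⊕ y) ≡ z · x + z · y
  ·-⊕ʳ z x y = trans (·-comm z (x ⊕ y)) (trans (·-⊕ˡ x y z) (cong₂ _+_ (·-comm x z) (·-comm y z)))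

  ·-⊖ʳ : (z x y : Vector ℤ n) → z · (x ⊖ y) ≡ z · x - z · y
  ·-⊖ʳ z x y = trans (·-comm z (x ⊖ y)) (trans (·-⊖ˡ x y z) (cong₂ _-_ (·-comm x z) (·-comm y z)))

  ·-⊛ʳ : ∀ c (z x : Vector ℤ n) → z · (c ⊛ x) ≡ c * (z · x)
  ·-⊛ʳ c z x = trans (·-comm z (c ⊛ x)) (trans (·-⊛ˡ c x z) (cong (c *_) (·-comm x z)))

  ·-δʳ : (x : Vector ℤ n) (a : Fin n) → x · δ a ≡ x a
  ·-δʳ x zero = trans (cong₂ _+_ (ℤ.*-identityʳ (x zero)) (sum-zero (λ i → ℤ.*-zeroʳ (x (suc i)))))
                      (ℤ.+-identityʳ (x zero))
  ·-δʳ x (suc a) = trans (cong₂ _+_ (ℤ.*-zeroʳ (x zero)) (·-δʳ (x ∘ suc) a)) (ℤ.+-identityˡ (x (suc a)))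

  ·-δˡ : (a : Fin n) (x : Vector ℤ n) → δ a · x ≡ x a
  ·-δˡ a x = trans (·-comm (δ a) x) (·-δʳ x a)

  δ-sym : (a b : Fin n) → δ a b ≡ δ b a
  δ-sym a b = trans (sym (·-δʳ (δ a) b)) (·-δˡ a (δ b))

  0≤x·x : (x : Vector ℤ n) → 0ℤ ≤ x · x
  0≤x·x x = 0≤sum (λ i → 0≤i*i (x i))

  𝟏·x : (x : Vector ℤ n) → 𝟏 · x ≡ sum x
  𝟏·x x = sum-cong-≗ (λ i → ℤ.*-identityˡ (x i))

  lin : (Fin n → Vector ℤ N) → Vector ℤ n → Vector ℤ N
  lin G x j = x · (λ i → G i j)

  lin-δ : (G : Fin n → Vector ℤ N) (a : Fin n) → lin G (δ a) ≗ G a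
  lin-δ G a j = ·-δˡ a _

  lin-· : (G : Fin n → Vector ℤ N) (x : Vector ℤ n) (y : Vector ℤ N) →
          lin G x · y ≡ x · (λ i → G i · y)
  lin-· G x y = begin
    sum (λ j → sum (λ i → x i * G i j) * y j)
      ≡⟨ sum-cong-≗ (λ j → *-distribʳ-sum (y j) (λ i → x i * G i j)) ⟩
    sum (λ j → sum (λ i → x i * G i j * y j))
      ≡⟨ ∑-comm (λ j i → x i * G i j * y j) ⟩
    sum (λ i → sum (λ j → x i * G i j * y j))
      ≡⟨ sum-cong-≗ (λ i → sum-cong-≗ (λ j → ℤ.*-assoc (x i) (G i j) (y j))) ⟩
    sum (λ i → sum (λ j → x i * (G i j * y j)))
      ≡⟨ sum-cong-≗ (λ i → sym (*-distribˡ-sum (x i) (λ j → G i j * y j))) ⟩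
    sum (λ i → x i * (G i · y)) ∎
    where open ≡-Reasoning

  Orthogonal : ℤ → (Fin n → Vector ℤ N) → Set
  Orthogonal c q = ∀ i k → q i · q k ≡ c * δ i k

  lin-·-orthogonal : ∀ {c} {q : Fin n → Vector ℤ N} → Orthogonal c q →
                     ∀ i t → q i · lin q t ≡ c * t i
  lin-·-orthogonal {c = c} {q} orth i t = begin
    q i · lin q t             ≡⟨ ·-comm (q i) (lin q t) ⟩
    lin q t · q i             ≡⟨ lin-· q t (q i) ⟩
    t · (λ k → q k · q i)     ≡⟨ ·-cong {x = t} (λ _ → refl) (λ k → trans (·-comm (q k) (q i)) (orth i k)) ⟩
    t · (c ⊛ δ i)             ≡⟨ ·-⊛ʳ c t (δ i) ⟩
    c * (t · δ i)             ≡⟨ cong (c *_) (·-δʳ t i) ⟩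
    c * t i                   ∎
    where open ≡-Reasoning

  lin-isometry : ∀ {c} {q : Fin n → Vector ℤ N} → Orthogonal c q →
                 ∀ t u → lin q t · lin q u ≡ c * (t · u)
  lin-isometry {c = c} {q} orth t u = begin
    lin q t · lin q u            ≡⟨ lin-· q t (lin q u) ⟩
    t · (λ i → q i · lin q u)    ≡⟨ ·-cong {x = t} (λ _ → refl)
        (λ i → lin-·-orthogonal {c = c} {q} orth i u) ⟩
    t · (c ⊛ u)                  ≡⟨ ·-⊛ʳ c t u ⟩
    c * (t · u)                  ∎
    where open ≡-Reasoning

  -- The vector `r` is `c` times the residue of `y` after orthogonal projection onto the span of the
  -- `q i`. The factor `c` avoids dividing by their squared norm, and `r · r ≥ 0` is `c` times the
  -- claim.
  bessel : ∀ {k} {q : Fin n → Vector ℤ N} → Orthogonal +[1+ k ] q →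
           ∀ y → sum (λ i → (y · q i) * (y · q i)) ≤ +[1+ k ] * (y · y)
  bessel {k = k} {q} orth y = cancel-*-≤ k (≤-by (r · r) (0≤x·x r) (sym r·r))
    where
    open ≡-Reasoning
    c : ℤ
    c = +[1+ k ]
    t : Vector ℤ _
    t i = y · q i
    r : Vector ℤ _
    r = c ⊛ y ⊖ lin q t
    ly : lin q t · y ≡ t · t
    ly = trans (lin-· q t y) (·-cong {x = t} (λ _ → refl) (λ i → ·-comm (q i) y))
    r·r : r · r ≡ c * (c * (y · y)) - c * (t · t)
    r·r = begin
      r · r
        ≡⟨ ·-⊖ˡ (c ⊛ y) (lin q t) r ⟩
      (c ⊛ y) · r - lin q t · r
        ≡⟨ cong₂ _-_ (trans (·-⊛ˡ c y r) (cong (c *_) (·-⊖ʳ y (c ⊛ y) (lin q t))))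
                     (·-⊖ʳ (lin q t) (c ⊛ y) (lin q t)) ⟩
      c * (y · (c ⊛ y) - y · lin q t) - (lin q t · (c ⊛ y) - lin q t · lin q t)
        ≡⟨ cong₂ (λ a b → c * (a - y · lin q t) - (b - lin q t · lin q t))
             (·-⊛ʳ c y y) (trans (·-⊛ʳ c (lin q t) y) (cong (c *_) ly)) ⟩
      c * (c * (y · y) - y · lin q t) - (c * (t · t) - lin q t · lin q t)
        ≡⟨ cong₂ (λ a b → c * (c * (y · y) - a) - (c * (t · t) - b))
             (trans (·-comm y (lin q t)) ly) (lin-isometry {c = c} {q} orth t t) ⟩
      c * (c * (y · y) - t · t) - (c * (t · t) - c * (t · t))
        ≡⟨ simp c (y · y) (t · t) ⟩
      c * (c * (y · y)) - c * (t · t) ∎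
      where
      simp : ∀ c Y T → c * (c * Y - T) - (c * T - c * T) ≡ c * (c * Y) - c * T
      simp = solve-∀

  -- Simplices in ℤᴺ

  0≤i*i-i : ∀ i → 0ℤ ≤ i * i - i
  0≤i*i-i (+ zero)  = ℤ.≤-refl
  0≤i*i-i +[1+ n ]  = subst (0ℤ ≤_) (eq +[1+ n ])
      (0≤* {+[1+ n ]} {+[1+ n ] - 1ℤ} (+≤+ z≤n) (≤⇒0≤- {1ℤ} {+[1+ n ]} (+≤+ (s≤s z≤n))))
    where
    eq : ∀ i → i * (i - 1ℤ) ≡ i * i - i
    eq = solve-∀
  0≤i*i-i -[1+ n ] = +≤+ z≤n

  𝟏·x≤x·x : (x : Vector ℤ n) → 𝟏 · x ≤ x · x
  𝟏·x≤x·x x = sum-mono (λ i → subst (_≤ x i * x i) (sym (ℤ.*-identityˡ (x i)))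
                                 (ℤ.0≤i-j⇒j≤i (0≤i*i-i (x i))))

  -x·x≤𝟏·x : (x : Vector ℤ n) → - (x · x) ≤ 𝟏 · x
  -x·x≤𝟏·x x = ≤-by _ (≤⇒0≤- (𝟏·x≤x·x ((- 1ℤ) ⊛ x)))
    (begin
      𝟏 · x - - (x · x)                       ≡⟨ eq (x · x) (𝟏 · x) ⟩
      - 1ℤ * (- 1ℤ * (x · x)) - - 1ℤ * (𝟏 · x)
        ≡⟨ sym (cong₂ _-_ (trans (·-⊛ˡ (- 1ℤ) x ((- 1ℤ) ⊛ x)) (cong (- 1ℤ *_) (·-⊛ʳ (- 1ℤ) x x)))
                          (·-⊛ʳ (- 1ℤ) 𝟏 x)) ⟩
      ((- 1ℤ) ⊛ x) · ((- 1ℤ) ⊛ x) - 𝟏 · ((- 1ℤ) ⊛ x) ∎)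
    where
    open ≡-Reasoning
    eq : ∀ A B → B - - A ≡ - 1ℤ * (- 1ℤ * A) - - 1ℤ * B
    eq = solve-∀

  -- The points of a regular simplex with squared edge length 4: differences
  -- behave like differences of orthogonal vectors of norm 2.
  IsSimplex : (Fin n → Vector ℤ N) → Set
  IsSimplex P = ∀ t → 𝟏 · t ≡ 0ℤ → lin P t · lin P t ≡ + 2 * (t · t)

  simplex-translate : {P : Fin n → Vector ℤ N} → IsSimplex P → ∀ c → IsSimplex (λ i → P i ⊖ c)
  simplex-translate {P = P} simplex c t 𝟏·t≡0 =
    trans (·-cong {x = lin (λ i → P i ⊖ c) t} {y = lin (λ i → P i ⊖ c) t} same same) (simplex t 𝟏·t≡0)
    where
    open ≡-Reasoning
    same : lin (λ i → P i ⊖ c) t ≗ lin P t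
    same j = begin
      t · (λ i → P i j - c j)
        ≡⟨ ·-⊖ʳ t (λ i → P i j) (λ _ → c j) ⟩
      lin P t j - t · (λ _ → c j)
        ≡⟨ cong (λ a → lin P t j - a) (trans
            (·-cong {x = t} (λ _ → refl) (λ _ → sym (ℤ.*-identityʳ (c j)))) (·-⊛ʳ (c j) t 𝟏)) ⟩
      lin P t j - c j * (t · 𝟏)
        ≡⟨ cong (λ a → lin P t j - c j * a) (trans (·-comm t 𝟏) 𝟏·t≡0) ⟩
      lin P t j - c j * 0ℤ
        ≡⟨ eq (lin P t j) (c j) ⟩
      lin P t j ∎
      where
      eq : ∀ a b → a - b * 0ℤ ≡ a
      eq = solve-∀

  i*i≤k*i⇒i≤k : ∀ i k → i * i ≤ + k * i → i ≤ + k
  i*i≤k*i⇒i≤k (+ zero)  k p = +≤+ z≤n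
  i*i≤k*i⇒i≤k +[1+ n ]  k p = ℤ.*-cancelʳ-≤-pos +[1+ n ] (+ k) +[1+ n ] p
  i*i≤k*i⇒i≤k -[1+ n ]  k p = -≤+

  -- A propositional length 13: sums over a literal Fin 13 would unfold.
  𝟏·𝟏 : m ≡ 13 → 𝟏 {m} · 𝟏 ≡ + 13
  𝟏·𝟏 refl = refl

  module _ (m≡13 : m ≡ 13) {P : Fin m → Vector ℤ N} (simplex : IsSimplex P) (j : Fin N) where

    private
      v : Vector ℤ m
      v i = P i j

    -- The point ∑ t i P i for t = 13 v - (𝟏 · v) 𝟏 has j-th coordinate D and squared
    -- norm 26 D, whence D² ≤ 26 D.
    simplex-variance : + 13 * (v · v) - (𝟏 · v) * (𝟏 · v) ≤ + 26
    simplex-variance = i*i≤k*i⇒i≤k D 26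
        (subst (D * D ≤_) norm (subst (λ a → a * a ≤ lin P t · lin P t) t·v
        (term≤sum {f = λ k → lin P t k * lin P t k} (λ k → 0≤i*i (lin P t k)) j)))
      where
      open ≡-Reasoning
      V D : ℤ
      V = 𝟏 · v
      D = + 13 * (v · v) - V * V
      t : Vector ℤ m
      t = + 13 ⊛ v ⊖ V ⊛ 𝟏
      t· : ∀ x → x · t ≡ + 13 * (x · v) - V * (x · 𝟏)
      t· x = trans (·-⊖ʳ x (+ 13 ⊛ v) (V ⊛ 𝟏)) (cong₂ _-_ (·-⊛ʳ (+ 13) x v) (·-⊛ʳ V x 𝟏))
      𝟏·t : 𝟏 · t ≡ 0ℤ
      𝟏·t = trans (t· 𝟏) (trans (cong (λ a → + 13 * V - V * a) (𝟏·𝟏 m≡13)) (eq V))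
        where
        eq : ∀ a → + 13 * a - a * + 13 ≡ 0ℤ
        eq = solve-∀
      t·v : t · v ≡ D
      t·v = trans (·-comm t v) (trans (t· v) (cong (λ a → + 13 * (v · v) - V * a) (·-comm v 𝟏)))
      t·t : t · t ≡ + 13 * D
      t·t = begin
        t · t                            ≡⟨ t· t ⟩
        + 13 * (t · v) - V * (t · 𝟏)     ≡⟨ cong₂ (λ a b → + 13 * a - V * b) t·v (trans (·-comm t 𝟏) 𝟏·t) ⟩
        + 13 * D - V * 0ℤ                ≡⟨ eq D V ⟩
        + 13 * D                         ∎
        where
        eq : ∀ a b → + 13 * a - b * 0ℤ ≡ + 13 * a
        eq = solve-∀
      norm : lin P t · lin P t ≡ + 26 * D
      norm = trans (simplex t 𝟏·t) (trans (cong (+ 2 *_) t·t) (sym (ℤ.*-assoc (+ 2) (+ 13) D)))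

    private
      spread : Fin m → ℤ
      spread i = (v ⊖ v i ⊛ 𝟏) · (v ⊖ v i ⊛ 𝟏)

      -- Each squared difference of two entries of the column is counted from both ends, whence the
      -- factor 2 in front of the variance.
      sum-spread : sum spread ≡ + 2 * (+ 13 * (v · v) - (𝟏 · v) * (𝟏 · v))
      sum-spread = begin
        sum spread
          ≡⟨ sum-cong-≗ expand ⟩
        sum ((v · v) ⊛ 𝟏 ⊖ (+ 2 * (𝟏 · v)) ⊛ v ⊕ + 13 ⊛ (λ i → v i * v i))
          ≡⟨ sym (𝟏·x ((v · v) ⊛ 𝟏 ⊖ (+ 2 * (𝟏 · v)) ⊛ v ⊕ + 13 ⊛ (λ i → v i * v i))) ⟩
        𝟏 · ((v · v) ⊛ 𝟏 ⊖ (+ 2 * (𝟏 · v)) ⊛ v ⊕ + 13 ⊛ (λ i → v i * v i))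
          ≡⟨ ·-⊕ʳ 𝟏 ((v · v) ⊛ 𝟏 ⊖ (+ 2 * (𝟏 · v)) ⊛ v) (+ 13 ⊛ (λ i → v i * v i)) ⟩
        𝟏 · ((v · v) ⊛ 𝟏 ⊖ (+ 2 * (𝟏 · v)) ⊛ v) + 𝟏 · (+ 13 ⊛ (λ i → v i * v i))
          ≡⟨ cong₂ _+_ (trans (·-⊖ʳ 𝟏 ((v · v) ⊛ 𝟏) ((+ 2 * (𝟏 · v)) ⊛ v))
                          (cong₂ _-_ (trans (·-⊛ʳ (v · v) 𝟏 (𝟏 {m})) (cong ((v · v) *_) (𝟏·𝟏 m≡13)))
                              (·-⊛ʳ (+ 2 * (𝟏 · v)) 𝟏 v)))
                       (trans (·-⊛ʳ (+ 13) 𝟏 (λ i → v i * v i)) (cong (+ 13 *_) (𝟏·x (λ i → v i * v i)))) ⟩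
        (v · v) * + 13 - + 2 * (𝟏 · v) * (𝟏 · v) + + 13 * (v · v)
          ≡⟨ eq (v · v) (𝟏 · v) ⟩
        + 2 * (+ 13 * (v · v) - (𝟏 · v) * (𝟏 · v)) ∎
        where
        open ≡-Reasoning
        eq : ∀ A V → A * + 13 - + 2 * V * V + + 13 * A ≡ + 2 * (+ 13 * A - V * V)
        eq = solve-∀
        expand : ∀ i → spread i ≡ (v · v) * 1ℤ - + 2 * (𝟏 · v) * v i + + 13 * (v i * v i)
        expand i = begin
          (v ⊖ a ⊛ 𝟏) · (v ⊖ a ⊛ 𝟏)
            ≡⟨ ·-⊖ˡ v (a ⊛ 𝟏) (v ⊖ a ⊛ 𝟏) ⟩
          v · (v ⊖ a ⊛ 𝟏) - (a ⊛ 𝟏) · (v ⊖ a ⊛ 𝟏)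
            ≡⟨ cong₂ _-_ (trans (·-⊖ʳ v v (a ⊛ 𝟏))
                (cong (λ b → v · v - b) (trans (·-⊛ʳ a v 𝟏) (cong (a *_) (·-comm v 𝟏)))))
                         (trans (·-⊛ˡ a 𝟏 (v ⊖ a ⊛ 𝟏)) (cong (a *_)
                             (trans (·-⊖ʳ 𝟏 v (a ⊛ 𝟏)) (cong (λ b → 𝟏 · v - b)
                             (trans (·-⊛ʳ a 𝟏 (𝟏 {m})) (cong (a *_) (𝟏·𝟏 m≡13))))))) ⟩
          (v · v - a * (𝟏 · v)) - a * (𝟏 · v - a * + 13)
            ≡⟨ eq₁ (v · v) (𝟏 · v) a ⟩
          (v · v) * 1ℤ - + 2 * (𝟏 · v) * a + + 13 * (a * a) ∎
          where
          a : ℤ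
          a = v i
          eq₁ : ∀ A V a → (A - a * V) - a * (V - a * + 13) ≡ A * 1ℤ - + 2 * V * a + + 13 * (a * a)
          eq₁ = solve-∀

    -- Averaging: the variance bound 26 makes the spreads total at most 52, while thirteen integers
    -- above 4 would total at least 65.
    ∃-small-spread : ∃ λ i → spread i ≤ + 4
    ∃-small-spread with Fin.any? (λ i → spread i ℤ.≤? + 4)
    ... | yes p = p
    ... | no ¬p = contradiction
      (ℤ.≤-trans (subst (_≤ sum spread) 5*13
          (sum-mono {f = λ _ → + 5} (λ i → ℤ.i<j⇒suc[i]≤j (ℤ.≰⇒> (λ q → ¬p (i , q))))))
        (subst (_≤ + 52) (sym sum-spread) (ℤ.*-monoˡ-≤-nonNeg (+ 2) simplex-variance)))
      (from-no (+ 65 ℤ.≤? + 52))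
      where
      5*13 : sum {m} (λ _ → + 5) ≡ + 65
      5*13 = trans (sum-const m (+ 5)) (cong (λ l → + l * + 5) m≡13)

  module _ (m≡13 : m ≡ 13) {P : Fin m → Vector ℤ N} (simplex : IsSimplex P) (j : Fin N) where

    -- The centre is the entry of small spread. An integer vector of squared norm `a` has coordinate
    -- sum at most `a` in absolute value, so after recentring the variance bound gives
    -- `13 a - a² ≤ 26`, which fails for the remaining values 3 and 4.
    ∃-center : ∃ λ c → (λ i → P i j - c) · (λ i → P i j - c) ≤ + 2
    ∃-center = P i j , small (u · u) (0≤x·x u) u·u≤4 variance
      where
      i : Fin m
      i = proj₁ (∃-small-spread m≡13 simplex j)
      u : Vector ℤ m
      u k = P k j - P i j
      u·u≤4 : u · u ≤ + 4
      u·u≤4 = subst (_≤ + 4) (·-cong {y = λ k → P k j - P i j * 1ℤ} u≗ u≗)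
          (proj₂ (∃-small-spread m≡13 simplex j))
        where
        u≗ : ∀ k → P k j - P i j * 1ℤ ≡ P k j - P i j
        u≗ k = cong (λ a → P k j - a) (ℤ.*-identityʳ (P i j))
      variance : + 13 * (u · u) - (u · u) * (u · u) ≤ + 26
      variance = ℤ.≤-trans
        (≤-by _ (0≤* (≤⇒0≤- (𝟏·x≤x·x u)) (≤⇒0≤- (-x·x≤𝟏·x u))) (eq (u · u) (𝟏 · u)))
        (simplex-variance m≡13 (simplex-translate simplex (P i)) j)
        where
        eq : ∀ A B → (+ 13 * A - B * B) - (+ 13 * A - A * A) ≡ (A - B) * (B - - A)
        eq = solve-∀
      small : ∀ a → 0ℤ ≤ a → a ≤ + 4 → + 13 * a - a * a ≤ + 26 → a ≤ + 2
      small (+ 0) _ _ _ = +≤+ z≤n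
      small (+ 1) _ _ _ = +≤+ (s≤s z≤n)
      small (+ 2) _ _ _ = +≤+ (s≤s (s≤s z≤n))
      small (+ 3) _ _ p = contradiction p (from-no (+ 30 ℤ.≤? + 26))
      small (+ 4) _ _ p = contradiction p (from-no (+ 36 ℤ.≤? + 26))
      small (+ suc (suc (suc (suc (suc _))))) _ (+≤+ (s≤s (s≤s (s≤s (s≤s ()))))) _

  i*i≤2 : ∀ i → i * i ≤ + 2 → i ≡ 0ℤ ⊎ i ≡ 1ℤ ⊎ i ≡ - 1ℤ
  i*i≤2 (+ 0) _ = inj₁ refl
  i*i≤2 (+ 1) _ = inj₂ (inj₁ refl)
  i*i≤2 -[1+ 0 ] _ = inj₂ (inj₂ refl)
  i*i≤2 (+ suc (suc n)) (+≤+ (s≤s (s≤s p))) with () ← ℕ.m+n≤o⇒n≤o n p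
  i*i≤2 -[1+ suc n ] (+≤+ (s≤s (s≤s p))) with () ← ℕ.m+n≤o⇒n≤o n p

  module _ {u : Vector ℤ n} (u·u≤2 : u · u ≤ + 2) (i : Fin n) where

    private
      w B : ℤ
      w = u i
      B = 𝟏 · u
      r : Vector ℤ n
      r = u ⊖ w ⊛ δ i
      𝟏·r : 𝟏 · r ≡ B - w
      𝟏·r = trans (·-⊖ʳ 𝟏 u (w ⊛ δ i))
          (cong (λ a → B - a) (trans (·-⊛ʳ w 𝟏 (δ i)) (trans (cong (w *_) (·-δʳ 𝟏 i)) (ℤ.*-identityʳ w))))
      r·r : r · r ≡ u · u - w * w
      r·r = begin
        r · r
          ≡⟨ ·-⊖ʳ r u (w ⊛ δ i) ⟩
        r · u - r · (w ⊛ δ i)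
          ≡⟨ cong₂ _-_ (trans (·-⊖ˡ u (w ⊛ δ i) u)
              (cong (λ a → u · u - a) (trans (·-⊛ˡ w (δ i) u) (cong (w *_) (·-δˡ i u)))))
                       (trans (·-⊛ʳ w r (δ i)) (cong (w *_)
                           (trans (·-δʳ r i) (cong (λ a → w - w * a) (δ-refl i))))) ⟩
        (u · u - w * w) - w * (w - w * 1ℤ)
          ≡⟨ eq (u · u) w ⟩
        u · u - w * w ∎
        where
        open ≡-Reasoning
        eq : ∀ A w → (A - w * w) - w * (w - w * 1ℤ) ≡ A - w * w
        eq = solve-∀
      bounds : (- (+ 2 - w * w) ≤ B - w) × (B - w ≤ + 2 - w * w)
      bounds = ℤ.≤-trans (ℤ.neg-mono-≤ r·r≤) (subst (- (r · r) ≤_) 𝟏·r (-x·x≤𝟏·x r)) ,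
               ℤ.≤-trans (subst (_≤ r · r) 𝟏·r (𝟏·x≤x·x r)) r·r≤
        where
        r·r≤ : r · r ≤ + 2 - w * w
        r·r≤ = subst (_≤ + 2 - w * w) (sym r·r) (ℤ.+-monoˡ-≤ (- (w * w)) u·u≤2)
      w-cases : w ≡ 0ℤ ⊎ w ≡ 1ℤ ⊎ w ≡ - 1ℤ
      w-cases = i*i≤2 w (ℤ.≤-trans (term≤sum (λ k → 0≤i*i (u k)) i) u·u≤2)

    -- If `u i` is 1 or -1, the other entries have squared norm at most 1, hence a sum between -1
    -- and 1; so `u i` times the full sum lies between 0 and 2. If `u i` is 0, all terms vanish.
    short-column : (0ℤ ≤ u i * (𝟏 · u)) × (u i * (𝟏 · u) ≤ + 2 * (u i * u i))
    short-column with w | B | bounds | w-cases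
    ... | _ | B | _ | inj₁ refl = ℤ.≤-reflexive (sym (ℤ.*-zeroˡ B)) , ℤ.≤-reflexive (ℤ.*-zeroˡ B)
    ... | _ | B | lo , hi | inj₂ (inj₁ refl) = ≤-by _ (≤⇒0≤- lo) (eq₁ B) , ≤-by _ (≤⇒0≤- hi) (eq₂ B)
      where
      eq₁ : ∀ B → 1ℤ * B - 0ℤ ≡ (B - 1ℤ) - - (+ 2 - 1ℤ * 1ℤ)
      eq₁ = solve-∀
      eq₂ : ∀ B → + 2 * (1ℤ * 1ℤ) - 1ℤ * B ≡ (+ 2 - 1ℤ * 1ℤ) - (B - 1ℤ)
      eq₂ = solve-∀
    ... | _ | B | lo , hi | inj₂ (inj₂ refl) = ≤-by _ (≤⇒0≤- hi) (eq₁ B) , ≤-by _ (≤⇒0≤- lo) (eq₂ B)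
      where
      eq₁ : ∀ B → - 1ℤ * B - 0ℤ ≡ (+ 2 - - 1ℤ * - 1ℤ) - (B - - 1ℤ)
      eq₁ = solve-∀
      eq₂ : ∀ B → + 2 * (- 1ℤ * - 1ℤ) - - 1ℤ * B ≡ (B - - 1ℤ) - - (+ 2 - - 1ℤ * - 1ℤ)
      eq₂ = solve-∀

  -- At most two points deviate from the center in each coordinate, by 1 each.
  -- Summing the squared distances from q i to all q k then leaves 2 as the only
  -- possible value of q i · q i.
  simplex-center : m ≡ 13 → {P : Fin m → Vector ℤ N} → IsSimplex P →
                   ∃ λ c → Orthogonal (+ 2) (λ i → P i ⊖ c)
  simplex-center {m} {N} m≡13 {P} simplex = c , orth
    where
    open ≡-Reasoning
    c : Vector ℤ N
    c j = proj₁ (∃-center m≡13 simplex j)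
    q : Fin m → Vector ℤ N
    q i = P i ⊖ c
    z : Vector ℤ m
    z i = q i · q i
    Z : ℤ
    Z = 𝟏 · z
    Q : Vector ℤ N
    Q = lin q 𝟏

    sum-const′ : ∀ a → 𝟏 {m} · (λ _ → a) ≡ + 13 * a
    sum-const′ a = trans (𝟏·x {n = m} (λ _ → a)) (trans (sum-const m a) (cong (λ l → + l * a) m≡13))

    dist : ∀ i k → z i + z k - + 2 * (q i · q k) ≡ + 4 - + 4 * δ i k
    dist i k = begin
      z i + z k - + 2 * (q i · q k)
        ≡⟨ eq₁ (z i) (z k) (q i · q k) ⟩
      (z i - q i · q k) - (q i · q k - z k)
        ≡⟨ cong (λ a → (z i - q i · q k) - (a - z k)) (·-comm (q i) (q k)) ⟩
      (z i - q i · q k) - (q k · q i - z k)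
        ≡⟨ sym (trans (·-⊖ˡ (q i) (q k) (q i ⊖ q k))
            (cong₂ _-_ (·-⊖ʳ (q i) (q i) (q k)) (·-⊖ʳ (q k) (q i) (q k)))) ⟩
      (q i ⊖ q k) · (q i ⊖ q k)
        ≡⟨ sym (·-cong {x = lin q t} {y = lin q t} lin-t lin-t) ⟩
      lin q t · lin q t
        ≡⟨ simplex-translate simplex c t (trans (·-⊖ʳ 𝟏 (δ i) (δ k)) (cong₂ _-_ (·-δʳ 𝟏 i) (·-δʳ 𝟏 k))) ⟩
      + 2 * (t · t)
        ≡⟨ cong (+ 2 *_) (trans (·-⊖ˡ (δ i) (δ k) t) (cong₂ _-_ (·-δˡ i t) (·-δˡ k t))) ⟩
      + 2 * ((δ i i - δ k i) - (δ i k - δ k k))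
        ≡⟨ cong (+ 2 *_) (cong₂ _-_ (cong₂ _-_ (δ-refl i) (δ-sym k i))
            (cong (λ a → δ i k - a) (δ-refl k))) ⟩
      + 2 * ((1ℤ - δ i k) - (δ i k - 1ℤ))
        ≡⟨ eq₂ (δ i k) ⟩
      + 4 - + 4 * δ i k ∎
      where
      t : Vector ℤ m
      t = δ i ⊖ δ k
      lin-t : lin q t ≗ q i ⊖ q k
      lin-t j = trans (·-⊖ˡ (δ i) (δ k) (λ l → q l j)) (cong₂ _-_ (lin-δ q i j) (lin-δ q k j))
      eq₁ : ∀ a b c → a + b - + 2 * c ≡ (a - c) - (c - b)
      eq₁ = solve-∀
      eq₂ : ∀ d → + 2 * ((1ℤ - d) - (d - 1ℤ)) ≡ + 4 - + 4 * d
      eq₂ = solve-∀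

    sum-dist : ∀ i → + 13 * z i + Z - + 2 * (q i · Q) ≡ + 48
    sum-dist i = begin
      + 13 * z i + Z - + 2 * (q i · Q)
        ≡⟨ cong₂ (λ a b → a + Z - + 2 * b) (ℤ.*-comm (+ 13) (z i))
             (trans (·-comm (q i) Q) (trans (lin-· q 𝟏 (q i))
                 (·-cong {x = 𝟏} (λ _ → refl) (λ k → ·-comm (q k) (q i))))) ⟩
      z i * + 13 + Z - + 2 * (𝟏 · (λ k → q i · q k))
        ≡⟨ sym (trans (·-⊖ʳ 𝟏 (z i ⊛ 𝟏 ⊕ z) (+ 2 ⊛ (λ k → q i · q k)))
                 (cong₂ _-_ (trans (·-⊕ʳ 𝟏 (z i ⊛ 𝟏) z)
                     (cong (λ a → a + Z) (trans (·-⊛ʳ (z i) 𝟏 (𝟏 {m})) (cong (z i *_) (𝟏·𝟏 m≡13)))))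
                            (·-⊛ʳ (+ 2) 𝟏 (λ k → q i · q k)))) ⟩
      𝟏 · (z i ⊛ 𝟏 ⊕ z ⊖ + 2 ⊛ (λ k → q i · q k))
        ≡⟨ ·-cong {x = 𝟏} {y = z i ⊛ 𝟏 ⊕ z ⊖ + 2 ⊛ (λ k → q i · q k)} (λ _ → refl)
             (λ k → trans (cong (λ a → a + z k - + 2 * (q i · q k)) (ℤ.*-identityʳ (z i))) (dist i k)) ⟩
      𝟏 · ((λ _ → + 4) ⊖ + 4 ⊛ δ i)
        ≡⟨ trans (·-⊖ʳ 𝟏 (λ _ → + 4) (+ 4 ⊛ δ i))
            (cong₂ _-_ (sum-const′ (+ 4)) (trans (·-⊛ʳ (+ 4) 𝟏 (δ i)) (cong (+ 4 *_) (·-δʳ 𝟏 i)))) ⟩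
      + 48 ∎

    column : ∀ i j → (0ℤ ≤ q i j * Q j) × (q i j * Q j ≤ + 2 * (q i j * q i j))
    column i j = short-column {u = λ k → q k j} (proj₂ (∃-center m≡13 simplex j)) i

    lower : ∀ i → + 48 ≤ + 13 * z i + Z
    lower i = ≤-by (+ 2 * (q i · Q)) (0≤* {+ 2} (+≤+ z≤n) (0≤sum (λ j → proj₁ (column i j))))
                (trans (cong (λ a → + 13 * z i + Z - a) (sym (sum-dist i))) (eq (+ 13 * z i + Z) (q i · Q)))
      where
      eq : ∀ a b → a - (a - + 2 * b) ≡ + 2 * b
      eq = solve-∀

    -- The 9 is 13 - 2 * 2: the column bounds put `q i · Q` between 0 and `2 * z i` in `sum-dist`.
    upper : ∀ i → + 9 * z i + Z ≤ + 48
    upper i = ≤-by (+ 2 * (+ 2 * z i - q i · Q)) (0≤* {+ 2} (+≤+ z≤n) (≤⇒0≤- q·Q≤))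
                (trans (cong (λ a → a - (+ 9 * z i + Z)) (sym (sum-dist i))) (eq (z i) Z (q i · Q)))
      where
      q·Q≤ : q i · Q ≤ + 2 * z i
      q·Q≤ = subst (q i · Q ≤_) (sym (*-distribˡ-sum (+ 2) (λ j → q i j * q i j)))
          (sum-mono (λ j → proj₂ (column i j)))
      eq : ∀ z Z b → (+ 13 * z + Z - + 2 * b) - (+ 9 * z + Z) ≡ + 2 * (+ 2 * z - b)
      eq = solve-∀

    total : ∀ k → 𝟏 · (+ k ⊛ z ⊕ (λ _ → Z)) ≡ (+ k + + 13) * Z
    total k = begin
      𝟏 · (+ k ⊛ z ⊕ (λ _ → Z))          ≡⟨ ·-⊕ʳ (𝟏 {m}) (+ k ⊛ z) (λ _ → Z) ⟩
      𝟏 · (+ k ⊛ z) + 𝟏 {m} · (λ _ → Z)      ≡⟨ cong₂ _+_ (·-⊛ʳ (+ k) 𝟏 z) (sum-const′ Z) ⟩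
      + k * Z + + 13 * Z                 ≡⟨ sym (ℤ.*-distribʳ-+ Z (+ k) (+ 13)) ⟩
      (+ k + + 13) * Z                   ∎

    Z≥ : + 624 ≤ + 26 * Z
    Z≥ = subst₂ _≤_ (trans (sym (𝟏·x {n = m} (λ _ → + 48))) (sum-const′ (+ 48)))
        (trans (sym (𝟏·x (+ 13 ⊛ z ⊕ (λ _ → Z)))) (total 13))
        (sum-mono {f = λ _ → + 48} {g = + 13 ⊛ z ⊕ (λ _ → Z)} lower)

    Z≤ : + 22 * Z ≤ + 624
    Z≤ = subst₂ _≤_ (trans (sym (𝟏·x (+ 9 ⊛ z ⊕ (λ _ → Z)))) (total 9))
        (trans (sym (𝟏·x {n = m} (λ _ → + 48))) (sum-const′ (+ 48)))
        (sum-mono {f = + 9 ⊛ z ⊕ (λ _ → Z)} {g = λ _ → + 48} upper)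

    -- Averaging has given 24 ≤ `Z` ≤ 28. Then `9 * z i ≤ 24` and `13 * z i ≥ 20`, which leaves only
    -- 2; the multipliers here and in `z≥2` eliminate `Z`.
    z≤2 : ∀ i → z i ≤ + 2
    z≤2 i with z i ℤ.≤? + 2
    ... | yes p = p
    ... | no ¬p = contradiction (≤-by _
        (0≤+ (0≤+ (0≤* {+ 234} (+≤+ z≤n) (≤⇒0≤- (ℤ.i<j⇒suc[i]≤j (ℤ.≰⇒> ¬p))))
        (0≤* {+ 26} (+≤+ z≤n) (≤⇒0≤- (upper i)))) (≤⇒0≤- Z≥)) (eq (z i) Z))
                                (from-no (0ℤ ℤ.≤? - + 78))
      where
      eq : ∀ z Z → - + 78 - 0ℤ ≡ + 234 * (z - + 3) + + 26 * (+ 48 - (+ 9 * z + Z)) + (+ 26 * Z - + 624)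
      eq = solve-∀

    z≥2 : ∀ i → + 2 ≤ z i
    z≥2 i with + 2 ℤ.≤? z i
    ... | yes p = p
    ... | no ¬p = contradiction (≤-by _
        (0≤+ (0≤+ (0≤* {+ 286} (+≤+ z≤n) (≤⇒0≤- (ℤ.i<j⇒suc[i]≤j (ℤ.≰⇒> ¬p))))
        (0≤* {+ 22} (+≤+ z≤n) (≤⇒0≤- (lower i)))) (≤⇒0≤- Z≤)) (eq (z i) Z))
                                (from-no (0ℤ ℤ.≤? - + 146))
      where
      eq : ∀ z Z → - + 146 - 0ℤ ≡ + 286 * (+ 2 - (1ℤ + z)) + + 22 * ((+ 13 * z + Z) - + 48) +
          (+ 624 - + 22 * Z)
      eq = solve-∀

    orth : Orthogonal (+ 2) q
    orth i k = ℤ.*-cancelˡ-≡ (+ 2) _ _ (begin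
      + 2 * (q i · q k)
        ≡⟨ eq (q i · q k) (z i + z k) ⟩
      z i + z k - (z i + z k - + 2 * (q i · q k))
        ≡⟨ cong₂ (λ a b → a + b - (z i + z k - + 2 * (q i · q k))) (z≡2 i) (z≡2 k) ⟩
      + 4 - (z i + z k - + 2 * (q i · q k))
        ≡⟨ cong (λ a → + 4 - a) (dist i k) ⟩
      + 4 - (+ 4 - + 4 * δ i k)
        ≡⟨ eq₁ (δ i k) ⟩
      + 2 * (+ 2 * δ i k) ∎)
      where
      z≡2 : ∀ i → z i ≡ + 2
      z≡2 i = ℤ.≤-antisym (z≤2 i) (z≥2 i)
      eq : ∀ a b → + 2 * a ≡ b - (b - + 2 * a)
      eq = solve-∀
      eq₁ : ∀ d → + 4 - (+ 4 - + 4 * d) ≡ + 2 * (+ 2 * d)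
      eq₁ = solve-∀

  -- Reflected pairs of non-holes

  sum-δ-injective : {a : Fin m → Fin n} → Injective _≡_ _≡_ a → ∀ k → sum (λ i → δ (a i) k) ≤ 1ℤ
  sum-δ-injective {zero} inj k = +≤+ z≤n
  sum-δ-injective {suc m} {a = a} inj k with a zero Fin.≟ k
  ... | yes refl = ℤ.≤-reflexive (cong₂ _+_ (δ-refl (a zero))
          (sum-zero {f = λ i → δ (a (suc i)) (a zero)} (λ i → δ-≢ (λ eq → Fin.0≢1+n (sym (inj eq))))))
  ... | no a₀≢k = subst (_≤ 1ℤ) (sym
      (trans (cong (λ z → z + sum (λ i → δ (a (suc i)) k)) (δ-≢ a₀≢k)) (ℤ.+-identityˡ _)))
          (sum-δ-injective (Fin.suc-injective ∘ inj) k)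

  -- The cut between 24 and 25 separates the lower members from the upper ones. With injectivity of
  -- `s` and the common sum, it makes all the indices distinct, so the `p i` are orthogonal with
  -- squared norm 2.
  record Pairs {n} (s : Fin n → ℕ) (m σ : ℕ) : Set where
    field
      a b       : Fin m → Fin n
      injective : Injective _≡_ _≡_ a
      a≤24      : ∀ i → s (a i) ℕ.≤ 24
      25≤b      : ∀ i → 25 ℕ.≤ s (b i)
      s[a]+s[b] : ∀ i → s (a i) ℕ.+ s (b i) ≡ σ

    p : Fin m → Vector ℤ n
    p i = δ (a i) ⊕ δ (b i)

    ·-p : ∀ x i → x · p i ≡ x (a i) + x (b i)
    ·-p x i = trans (·-⊕ʳ x (δ (a i)) (δ (b i))) (cong₂ _+_ (·-δʳ x (a i)) (·-δʳ x (b i)))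

    0≤p : ∀ i k → 0ℤ ≤ p i k
    0≤p i k = 0≤+ (0≤δ (a i) k) (0≤δ (b i) k)

    a≢b : ∀ i k → a i ≢ b k
    a≢b i k eq = ℕ.<⇒≱ (25≤b k) (subst (λ l → s l ℕ.≤ 24) eq (a≤24 i))

    b-injective : Injective _≡_ _≡_ (λ i → s (a i)) → Injective _≡_ _≡_ b
    b-injective sa-inj {i} {k} eq = sa-inj (ℕ.+-cancelʳ-≡ (s (b i)) _ _
      (trans (s[a]+s[b] i) (sym (trans (cong (λ l → s (a k) ℕ.+ s l) eq) (s[a]+s[b] k)))))

    module _ (s-injective : Injective _≡_ _≡_ s) where

      private
        b-inj : Injective _≡_ _≡_ b
        b-inj = b-injective (injective ∘ s-injective)

      p-orthogonal : Orthogonal (+ 2) p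
      p-orthogonal i k = trans (·-p (p i) k) (go (i Fin.≟ k))
        where
        go : Dec (i ≡ k) → p i (a k) + p i (b k) ≡ + 2 * δ i k
        go (yes refl) = trans
          (cong₂ _+_ (cong₂ _+_ (δ-refl (a i)) (δ-≢ (a≢b i i ∘ sym)))
              (cong₂ _+_ (δ-≢ (a≢b i i)) (δ-refl (b i))))
          (cong (+ 2 *_) (sym (δ-refl i)))
        go (no i≢k) = trans
          (cong₂ _+_ (cong₂ _+_ (δ-≢ (i≢k ∘ injective)) (δ-≢ (a≢b k i ∘ sym)))
              (cong₂ _+_ (δ-≢ (a≢b i k)) (δ-≢ (i≢k ∘ b-inj))))
          (cong (+ 2 *_) (sym (δ-≢ i≢k)))

      sum-p≤1 : ∀ k → sum (λ i → p i k) ≤ 1ℤ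
      sum-p≤1 k = subst (_≤ 1ℤ) (sym (∑-distrib-+ (λ i → δ (a i) k) (λ i → δ (b i) k))) (go (s k ℕ.≤? 24))
        where
        go : Dec (s k ℕ.≤ 24) → sum (λ i → δ (a i) k) + sum (λ i → δ (b i) k) ≤ 1ℤ
        go (yes k≤24) = subst (_≤ 1ℤ) (sym
            (trans (cong (λ z → sum (λ i → δ (a i) k) + z) (sum-zero zeros)) (ℤ.+-identityʳ _)))
                          (sum-δ-injective injective k)
          where
          zeros : ∀ i → δ (b i) k ≡ 0ℤ
          zeros i = δ-≢ (λ eq → ℕ.<⇒≱ (25≤b i) (subst (λ l → s l ℕ.≤ 24) (sym eq) k≤24))
        go (no k≰24) = subst (_≤ 1ℤ) (sym
            (trans (cong (λ z → z + sum (λ i → δ (b i) k)) (sum-zero zeros)) (ℤ.+-identityˡ _)))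
                          (sum-δ-injective b-inj k)
          where
          zeros : ∀ i → δ (a i) k ≡ 0ℤ
          zeros i = δ-≢ (λ eq → k≰24 (subst (λ l → s l ℕ.≤ 24) eq (a≤24 i)))

  -- Two adjacent reflections v ↦ 49 - v and v ↦ 50 - v of {1, …, 49} occur:
  -- together with L, the sums e_a + e_b of reflected pairs span all even vectors.
  record Spectrum {n} (s : Fin n → ℕ) (m : ℕ) : Set where
    field
      injective : Injective _≡_ _≡_ s
      positive  : ∀ j → 1 ℕ.≤ s j
      small     : ∀ v → 1 ℕ.≤ v → v ℕ.≤ 6 → ∃ λ j → s j ≡ v
      dense     : ∀ j → 7 ℕ.≤ s j → ∃ λ y → 1 ℕ.+ s y ≡ s j ⊎ 2 ℕ.+ s y ≡ s j
      pairs₄₉   : Pairs s m 49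
      pairs₅₀   : Pairs s m 50

    ι : ∀ v {_ : True (1 ℕ.≤? v)} {_ : True (v ℕ.≤? 6)} → Fin n
    ι v {p} {q} = proj₁ (small v (toWitness p) (toWitness q))

    s[ι] : ∀ v {p : True (1 ℕ.≤? v)} {q : True (v ℕ.≤? 6)} → s (ι v {p} {q}) ≡ v
    s[ι] v {p} {q} = proj₂ (small v (toWitness p) (toWitness q))

  -- Minimal vectors of the lattice and the functionals that vanish on them

  InL : (s : Fin n → ℕ) → Vector ℤ n → Set
  InL s x = 𝟏 · x ≡ 0ℤ × (λ i → + s i) · x ≡ 0ℤ

  -- Two different pairs of indices with the same sum give a vector of squared norm 4 in L. That `d`
  -- differs from `b` and `c` follows from the equal sums.
  record Quad {n} (s : Fin n → ℕ) (a d b c : Fin n) : Set where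
    field
      sums : s a ℕ.+ s d ≡ s b ℕ.+ s c
      a≢d  : s a ≢ s d
      b≢c  : s b ≢ s c
      a≢b  : s a ≢ s b
      a≢c  : s a ≢ s c

    vec : Vector ℤ n
    vec = δ a ⊕ δ d ⊖ δ b ⊖ δ c

    ·-vec : ∀ x → x · vec ≡ x a + x d - x b - x c
    ·-vec x = trans (·-⊖ʳ x (δ a ⊕ δ d ⊖ δ b) (δ c)) (cong₂ _-_
      (trans (·-⊖ʳ x (δ a ⊕ δ d) (δ b)) (cong₂ _-_
        (trans (·-⊕ʳ x (δ a) (δ d)) (cong₂ _+_ (·-δʳ x a) (·-δʳ x d)))
        (·-δʳ x b))) (·-δʳ x c))

    vec∈L : InL s vec
    vec∈L = ·-vec 𝟏 , trans (·-vec (λ i → + s i)) (begin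
      + s a + + s d - + s b - + s c        ≡⟨ eq (+ s a + + s d) (+ s b) (+ s c) ⟩
      (+ s a + + s d) - (+ s b + + s c)    ≡⟨ cong (λ z → + z - (+ s b + + s c)) sums ⟩
      + (s b ℕ.+ s c) - + (s b ℕ.+ s c)    ≡⟨ ℤ.+-inverseʳ (+ (s b ℕ.+ s c)) ⟩
      0ℤ ∎)
      where
      open ≡-Reasoning
      eq : ∀ x y z → x - y - z ≡ x - (y + z)
      eq = solve-∀

    vec·vec : vec · vec ≡ + 4
    vec·vec = trans (·-vec vec) (cong₂ _-_ (cong₂ _-_ (cong₂ _+_
      (δs (δ-refl a) (δ≢ (a≢d ∘ sym)) (δ≢ (a≢b ∘ sym)) (δ≢ (a≢c ∘ sym)))
      (δs (δ≢ a≢d) (δ-refl d) (δ≢ (d≢b ∘ sym)) (δ≢ (d≢c ∘ sym))))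
      (δs (δ≢ a≢b) (δ≢ d≢b) (δ-refl b) (δ≢ (b≢c ∘ sym))))
      (δs (δ≢ a≢c) (δ≢ d≢c) (δ≢ b≢c) (δ-refl c)))
      where
      δ≢ : ∀ {k l} → s k ≢ s l → δ k l ≡ 0ℤ
      δ≢ sk≢sl = δ-≢ (sk≢sl ∘ cong s)
      d≢c : s d ≢ s c
      d≢c eq = a≢b (ℕ.+-cancelʳ-≡ (s d) _ _ (trans sums (cong (s b ℕ.+_) (sym eq))))
      d≢b : s d ≢ s b
      d≢b eq = a≢c (ℕ.+-cancelʳ-≡ (s d) _ _
          (trans sums (trans (ℕ.+-comm (s b) (s c)) (cong (s c ℕ.+_) (sym eq)))))
      δs : ∀ {x x′ y y′ z z′ t t′} → x ≡ x′ → y ≡ y′ → z ≡ z′ → t ≡ t′ → x + y - z - t ≡ x′ + y′ - z′ - t′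
      δs refl refl refl refl = refl

  module _ {s : Fin n → ℕ} (spectrum : Spectrum s m) where
    open Spectrum spectrum

    -- This is the dual form of the fact that the vectors of quads generate enough of L: a
    -- functional vanishing on them is a combination of the two functionals that define L, hence
    -- vanishes on L. Affinity is proved by induction on the value of `s`.
    quad⇒affine : (γ : Vector ℤ n) → (∀ {a d b c} → Quad s a d b c → γ a + γ d ≡ γ b + γ c) →
                  ∃ λ A → ∃ λ B → ∀ j → γ j ≡ A + B * + s j
    quad⇒affine γ quad = A , B , λ j → go (s j) j ℕ.≤-refl
      where
      open ≡-Reasoning
      mk : ∀ {a d b c va vd vb vc} → s a ≡ va → s d ≡ vd → s b ≡ vb → s c ≡ vc →
           va ℕ.+ vd ≡ vb ℕ.+ vc → va ≢ vd → vb ≢ vc → va ≢ vb → va ≢ vc → γ a + γ d ≡ γ b + γ c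
      mk refl refl refl refl sums ad bc ab ac =
        quad (record { sums = sums ; a≢d = ad ; b≢c = bc ; a≢b = ab ; a≢c = ac })
      A B : ℤ
      B = γ (ι 2) - γ (ι 1)
      A = γ (ι 1) - B
      Aff : Fin n → Set
      Aff j = γ j ≡ A + B * + s j
      at : ∀ {j k v} → s j ≡ v → s k ≡ v → γ k ≡ A + B * + v → Aff j
      at {j} refl sk≡ γk = trans (cong γ (injective (sym sk≡))) γk
      -- The relation 1 + 3 = 2 + 2 repeats an index and is no quad. It is the sum of 2 + 5 = 3 + 4
      -- and 1 + 5 = 2 + 4 after cancellation.
      γ₃ : γ (ι 3) ≡ γ (ι 2) + (γ (ι 2) - γ (ι 1))
      γ₃ = begin
        γ (ι 3)                                      ≡⟨ eq₁ (γ (ι 3)) (γ (ι 4)) ⟩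
        γ (ι 3) + γ (ι 4) - γ (ι 4)                        ≡⟨ cong (λ z → z - γ (ι 4))
            (sym (mk (s[ι] 2) (s[ι] 5) (s[ι] 3) (s[ι] 4) refl (λ ()) (λ ()) (λ ()) (λ ()))) ⟩
        γ (ι 2) + γ (ι 5) - γ (ι 4)                        ≡⟨ eq₂ (γ (ι 1)) (γ (ι 2)) (γ (ι 4)) (γ (ι 5)) ⟩
        γ (ι 2) + ((γ (ι 1) + γ (ι 5)) - γ (ι 4) - γ (ι 1))      ≡⟨ cong
            (λ z → γ (ι 2) + (z - γ (ι 4) - γ (ι 1)))
            (mk (s[ι] 1) (s[ι] 5) (s[ι] 2) (s[ι] 4) refl (λ ()) (λ ()) (λ ()) (λ ())) ⟩
        γ (ι 2) + ((γ (ι 2) + γ (ι 4)) - γ (ι 4) - γ (ι 1))      ≡⟨ eq₃ (γ (ι 1)) (γ (ι 2)) (γ (ι 4)) ⟩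
        γ (ι 2) + (γ (ι 2) - γ (ι 1))                      ∎
        where
        eq₁ : ∀ a b → a ≡ a + b - b
        eq₁ = solve-∀
        eq₂ : ∀ a b d f → b + f - d ≡ b + ((a + f) - d - a)
        eq₂ = solve-∀
        eq₃ : ∀ a b d → b + ((b + d) - d - a) ≡ b + (b - a)
        eq₃ = solve-∀
      a₁ : γ (ι 1) ≡ A + B * + 1
      a₁ = eq (γ (ι 1)) (γ (ι 2))
        where
        eq : ∀ x y → x ≡ (x - (y - x)) + (y - x) * + 1
        eq = solve-∀
      a₂ : γ (ι 2) ≡ A + B * + 2
      a₂ = eq (γ (ι 1)) (γ (ι 2))
        where
        eq : ∀ x y → y ≡ (x - (y - x)) + (y - x) * + 2
        eq = solve-∀
      a₃ : γ (ι 3) ≡ A + B * + 3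
      a₃ = trans γ₃ (eq (γ (ι 1)) (γ (ι 2)))
        where
        eq : ∀ x y → y + (y - x) ≡ (x - (y - x)) + (y - x) * + 3
        eq = solve-∀
      extend : ∀ {j y k} v u w → γ j + γ (ι 1) ≡ γ y + γ k →
               v ℕ.+ 1 ≡ u ℕ.+ w → γ y ≡ A + B * + u → γ k ≡ A + B * + w → γ j ≡ A + B * + v
      extend {j} {y} {k} v u w quad v+1≡u+w γy γk = begin
        γ j                                                    ≡⟨ eq₁ (γ j) (γ (ι 1)) ⟩
        γ j + γ (ι 1) - γ (ι 1)                                      ≡⟨ cong₂ _-_
            (trans quad (cong₂ _+_ γy γk)) a₁ ⟩
        (A + B * + u + (A + B * + w)) - (A + B * + 1)          ≡⟨ eq₂ A B (+ u) (+ w) ⟩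
        A + B * (+ u + + w - 1ℤ)                               ≡⟨ cong (λ z → A + B * (z - 1ℤ))
            (cong (+_) (sym v+1≡u+w)) ⟩
        A + B * (+ v + 1ℤ - 1ℤ)                                ≡⟨ cong (λ z → A + B * z)
            (sym (eq₁ (+ v) 1ℤ)) ⟩
        A + B * + v                                            ∎
        where
        eq₁ : ∀ a b → a ≡ a + b - b
        eq₁ = solve-∀
        eq₂ : ∀ A B u w → (A + B * u + (A + B * w)) - (A + B * + 1) ≡ A + B * (u + w - 1ℤ)
        eq₂ = solve-∀
      a₄ : γ (ι 4) ≡ A + B * + 4
      a₄ = extend 4 2 3 (mk (s[ι] 4) (s[ι] 1) (s[ι] 2) (s[ι] 3) refl (λ ()) (λ ()) (λ ()) (λ ())) refl a₂ a₃
      a₅ : γ (ι 5) ≡ A + B * + 5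
      a₅ = extend 5 2 4 (mk (s[ι] 5) (s[ι] 1) (s[ι] 2) (s[ι] 4) refl (λ ()) (λ ()) (λ ()) (λ ())) refl a₂ a₄
      a₆ : γ (ι 6) ≡ A + B * + 6
      a₆ = extend 6 2 5 (mk (s[ι] 6) (s[ι] 1) (s[ι] 2) (s[ι] 5) refl (λ ()) (λ ()) (λ ()) (λ ())) refl a₂ a₅
      far : ∀ {u} v w {_ : True (suc w ℕ.≤? v)} → v ℕ.≤ u → u ≢ w
      far v w {w<v} v≤u refl = ℕ.<⇒≱ (toWitness w<v) v≤u
      go : ∀ v j → s j ℕ.≤ v → Aff j
      base : ∀ v j → s j ≡ v → v ℕ.≤ 6 → Aff j
      base 0 j eq _ = contradiction (positive j) (λ p → ℕ.<⇒≱ p (ℕ.≤-reflexive eq))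
      base 1 j eq _ = at eq (s[ι] 1) a₁
      base 2 j eq _ = at eq (s[ι] 2) a₂
      base 3 j eq _ = at eq (s[ι] 3) a₃
      base 4 j eq _ = at eq (s[ι] 4) a₄
      base 5 j eq _ = at eq (s[ι] 5) a₅
      base 6 j eq _ = at eq (s[ι] 6) a₆
      base (suc (suc (suc (suc (suc (suc (suc _))))))) j eq (s≤s (s≤s (s≤s (s≤s (s≤s (s≤s ()))))))
      go v j sj≤v with s j ℕ.≤? 6
      go v j sj≤v | yes sj≤6 = base (s j) j refl sj≤6
      go zero j sj≤v | no sj≰6 = contradiction (ℕ.≤-trans sj≤v z≤n) sj≰6
      -- A value `v` from 7 on is reached by `v + 1 = (v - 1) + 2`, or, when `v - 1` is a hole, by
      -- `v + 1 = (v - 2) + 3`; since `v` is at least 7, the four members are distinct.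
      go (suc v) j sj≤v | no sj≰6 with dense j (ℕ.≰⇒> sj≰6)
      ... | y , inj₁ eq = extend (s j) (s y) 2
              (mk refl (s[ι] 1) refl (s[ι] 2) sums (far 7 1 7≤sj) (far 6 2 6≤sy)
                  (λ eq′ → ℕ.1+n≢n (trans eq eq′)) (far 7 2 7≤sj))
              sums (go v y (ℕ.≤-pred (subst (ℕ._≤ suc v) (sym eq) sj≤v))) a₂
        where
        7≤sj : 7 ℕ.≤ s j
        7≤sj = ℕ.≰⇒> sj≰6
        6≤sy : 6 ℕ.≤ s y
        6≤sy = ℕ.≤-pred (subst (7 ℕ.≤_) (sym eq) 7≤sj)
        sums : s j ℕ.+ 1 ≡ s y ℕ.+ 2
        sums = trans (cong (ℕ._+ 1) (sym eq)) (trans (ℕ.+-comm (1 ℕ.+ s y) 1) (ℕ.+-comm 2 (s y)))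
      ... | y , inj₂ eq = extend (s j) (s y) 3
              (mk refl (s[ι] 1) refl (s[ι] 3) sums (far 7 1 7≤sj) (far 5 3 5≤sy)
                  (λ eq′ → ℕ.m≢1+n+m (s y) (sym (trans eq eq′))) (far 7 3 7≤sj))
              sums (go v y (ℕ.≤-trans (ℕ.n≤1+n (s y)) (ℕ.≤-pred (subst (ℕ._≤ suc v) (sym eq) sj≤v)))) a₃
        where
        7≤sj : 7 ℕ.≤ s j
        7≤sj = ℕ.≰⇒> sj≰6
        5≤sy : 5 ℕ.≤ s y
        5≤sy = ℕ.≤-pred (ℕ.≤-pred (subst (7 ℕ.≤_) (sym eq) 7≤sj))
        sums : s j ℕ.+ 1 ≡ s y ℕ.+ 3
        sums = trans (cong (ℕ._+ 1) (sym eq)) (trans (ℕ.+-comm (2 ℕ.+ s y) 1) (ℕ.+-comm 3 (s y)))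

  affine-annihilates : {s : Fin n → ℕ} {γ : Vector ℤ n} → (∃ λ A → ∃ λ B → ∀ j → γ j ≡ A + B * + s j) →
                       ∀ {x} → InL s x → x · γ ≡ 0ℤ
  affine-annihilates {s = s} {γ} (A , B , γ≡) {x} (𝟏·x≡0 , s·x≡0) = begin
    x · γ
      ≡⟨ ·-cong {x = x} {y′ = A ⊛ 𝟏 ⊕ B ⊛ (λ i → + s i)} (λ _ → refl)
           (λ j → trans (γ≡ j) (cong (λ a → a + B * + s j) (sym (ℤ.*-identityʳ A)))) ⟩
    x · (A ⊛ 𝟏 ⊕ B ⊛ (λ i → + s i))
      ≡⟨ trans (·-⊕ʳ x (A ⊛ 𝟏) (B ⊛ (λ i → + s i))) (cong₂ _+_ (·-⊛ʳ A x 𝟏) (·-⊛ʳ B x (λ i → + s i))) ⟩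
    A * (x · 𝟏) + B * (x · (λ i → + s i))
      ≡⟨ cong₂ (λ a b → A * a + B * b) (trans (·-comm x 𝟏) 𝟏·x≡0) (trans (·-comm x (λ i → + s i)) s·x≡0) ⟩
    A * 0ℤ + B * 0ℤ
      ≡⟨ cong₂ _+_ (ℤ.*-zeroʳ A) (ℤ.*-zeroʳ B) ⟩
    0ℤ ∎
    where open ≡-Reasoning

  -- Extension of the isometry from L to all integer vectors

  1≤[κ+b]²+β : ∀ κ b β → κ ≢ 0ℤ → b ≤ β → - b ≤ β → 1ℤ ≤ (κ + b) * (κ + b) + β
  1≤[κ+b]²+β κ +[1+ n ] β κ≢0 b≤β _ = ℤ.+-mono-≤ (0≤i*i (κ + +[1+ n ])) (ℤ.≤-trans (+≤+ (s≤s z≤n)) b≤β)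
  1≤[κ+b]²+β κ -[1+ n ] β κ≢0 _ -b≤β = ℤ.+-mono-≤ (0≤i*i (κ + -[1+ n ])) (ℤ.≤-trans (+≤+ (s≤s z≤n)) -b≤β)
  1≤[κ+b]²+β κ (+ 0) β κ≢0 0≤β _ =
      ℤ.+-mono-≤ (subst (λ a → 1ℤ ≤ a * a) (sym (ℤ.+-identityʳ κ)) (1≤κ² κ κ≢0)) 0≤β
    where
    1≤κ² : ∀ κ → κ ≢ 0ℤ → 1ℤ ≤ κ * κ
    1≤κ² (+ 0) κ≢0 = contradiction refl κ≢0
    1≤κ² +[1+ n ] _ = +≤+ (s≤s z≤n)
    1≤κ² -[1+ n ] _ = +≤+ (s≤s z≤n)

  -- If κ ≢ 0, then a i ≢ 0 wherever b i ≡ 0, so that every a i² + β i is positive.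
  constant-deviation : m ≡ 13 → ∀ {κ : ℤ} {a b β : Vector ℤ m} (A B : ℤ) →
    (∀ i → a i - b i ≡ κ) → (∀ i → b i ≤ β i) → (∀ i → - b i ≤ β i) →
    sum (λ i → a i * a i) ≤ A → sum β ≤ B → A + B < + 13 → κ ≡ 0ℤ
  constant-deviation {m} m≡13 {κ} {a} {b} {β} A B a-b≡κ b≤β -b≤β a≤A β≤B A+B<13 with κ ℤ.≟ 0ℤ
  ... | yes κ≡0 = κ≡0
  ... | no κ≢0 = contradiction A+B<13 (ℤ.≤⇒≯ (begin
    + 13                                     ≡⟨ sym (trans (sum-const m 1ℤ) (cong (λ l → + l * 1ℤ) m≡13)) ⟩
    sum {m} (λ _ → 1ℤ)                       ≤⟨ sum-mono {g = λ i → a i * a i + β i} step ⟩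
    sum (λ i → a i * a i + β i)              ≡⟨ ∑-distrib-+ (λ i → a i * a i) β ⟩
    sum (λ i → a i * a i) + sum β            ≤⟨ ℤ.+-mono-≤ a≤A β≤B ⟩
    A + B                                    ∎))
    where
    open ℤ.≤-Reasoning
    eq : ∀ a b → (a - b) + b ≡ a
    eq = solve-∀
    step : ∀ i → 1ℤ ≤ a i * a i + β i
    step i = subst (λ z → 1ℤ ≤ z * z + β i) (trans (cong (λ z → z + b i) (sym (a-b≡κ i))) (eq (a i) (b i)))
               (1≤[κ+b]²+β κ (b i) (β i) κ≢0 (b≤β i) (-b≤β i))

  -- The map `lin G` is defined on every integer vector, but it represents the isometry on L only;
  -- off L its values are an arbitrary linear choice, to be corrected later.
  record Embedding {n N} (s : Fin n → ℕ) : Set where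
    field
      G        : Fin n → Vector ℤ N
      isometry : ∀ {x y} → InL s x → InL s y → lin G x · lin G y ≡ x · y

  module _ {s : Fin n → ℕ} (m≡13 : m ≡ 13) (spectrum : Spectrum s m) (embedding : Embedding {n} {N} s) where
    open Spectrum spectrum
    open Embedding embedding

    private
      w : Vector ℤ n
      w i = + s i

      infix 4 _∈L
      _∈L : Vector ℤ n → Set
      x ∈L = InL s x

    module Frame {σ} (pairs : Pairs s m σ) where
      open Pairs pairs hiding (injective)

      p-orth : Orthogonal (+ 2) p
      p-orth = p-orthogonal injective

      𝟏·p : ∀ i → 𝟏 · p i ≡ + 2
      𝟏·p i = ·-p 𝟏 i

      w·p : ∀ i → w · p i ≡ + σ
      w·p i = trans (·-p w i) (cong (+_) (s[a]+s[b] i))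

      -- The `p i` lie outside L, so the points `P i` depend on the choice of `G`; their differences
      -- do not. Subtracting the centre of the simplex removes the ambiguity.
      P : Fin m → Vector ℤ N
      P i = lin G (p i)

      lin-p∈L : ∀ t → 𝟏 · t ≡ 0ℤ → lin p t ∈L
      lin-p∈L t 𝟏·t≡0 = zero-on 𝟏 (+ 2) 𝟏·p , zero-on w (+ σ) w·p
        where
        open ≡-Reasoning
        zero-on : ∀ u c → (∀ i → u · p i ≡ c) → u · lin p t ≡ 0ℤ
        zero-on u c u·p = begin
          u · lin p t              ≡⟨ ·-comm u (lin p t) ⟩
          lin p t · u              ≡⟨ lin-· p t u ⟩
          t · (λ i → p i · u)      ≡⟨ ·-cong {x = t} (λ _ → refl)
              (λ i → trans (·-comm (p i) u) (trans (u·p i) (sym (ℤ.*-identityʳ c)))) ⟩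
          t · (c ⊛ 𝟏)              ≡⟨ ·-⊛ʳ c t 𝟏 ⟩
          c * (t · 𝟏)              ≡⟨ cong (c *_) (trans (·-comm t 𝟏) 𝟏·t≡0) ⟩
          c * 0ℤ                   ≡⟨ ℤ.*-zeroʳ c ⟩
          0ℤ                       ∎

      lin-P : ∀ t → lin P t ≗ lin G (lin p t)
      lin-P t j = sym (lin-· p t (λ i → G i j))

      P-simplex : IsSimplex P
      P-simplex t 𝟏·t≡0 = begin
        lin P t · lin P t                        ≡⟨ ·-cong {x = lin P t} {y = lin P t} (lin-P t) (lin-P t) ⟩
        lin G (lin p t) · lin G (lin p t)        ≡⟨ isometry (lin-p∈L t 𝟏·t≡0) (lin-p∈L t 𝟏·t≡0) ⟩
        lin p t · lin p t                        ≡⟨ lin-isometry {c = + 2} {p} p-orth t t ⟩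
        + 2 * (t · t)                            ∎
        where open ≡-Reasoning

      c : Vector ℤ N
      c = proj₁ (simplex-center m≡13 {P} P-simplex)

      q : Fin m → Vector ℤ N
      q i = P i ⊖ c

      q-orth : Orthogonal (+ 2) q
      q-orth = proj₂ (simplex-center m≡13 {P} P-simplex)

      q-differences : ∀ i k → q i ⊖ q k ≗ lin G (p i ⊖ p k)
      q-differences i k j = trans (eq (P i j) (P k j) (c j)) (sym (·-⊖ˡ (p i) (p k) (λ l → G l j)))
        where
        eq : ∀ a b c → (a - c) - (b - c) ≡ a - b
        eq = solve-∀

      p-differences : ∀ i k → (p i ⊖ p k) ∈L
      p-differences i k =
        trans (·-⊖ʳ 𝟏 (p i) (p k)) (cong₂ _-_ (𝟏·p i) (𝟏·p k)) ,
        trans (·-⊖ʳ w (p i) (p k)) (trans (cong₂ _-_ (w·p i) (w·p k)) (ℤ.+-inverseʳ (+ σ)))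

      constant-difference : ∀ {y z} → (∀ i k → y · (q i ⊖ q k) ≡ z · (p i ⊖ p k)) →
                            ∀ i k → y · q i - z · p i ≡ y · q k - z · p k
      constant-difference {y} {z} same i k = begin
        y · q i - z · p i
          ≡⟨ eq₁ (y · q i) (y · q k) (z · p i) ⟩
        (y · q i - y · q k) + y · q k - z · p i
          ≡⟨ cong (λ a → a + y · q k - z · p i)
              (trans (sym (·-⊖ʳ y (q i) (q k))) (trans (same i k) (·-⊖ʳ z (p i) (p k)))) ⟩
        (z · p i - z · p k) + y · q k - z · p i
          ≡⟨ eq₂ (z · p i) (z · p k) (y · q k) ⟩
        y · q k - z · p k ∎
        where
        open ≡-Reasoning
        eq₁ : ∀ a b c → a - c ≡ (a - b) + b - c
        eq₁ = solve-∀
        eq₂ : ∀ c d b → (c - d) + b - c ≡ b - d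
        eq₂ = solve-∀

      L-difference : ∀ {x} → x ∈L → ∀ i k → lin G x · (q i ⊖ q k) ≡ x · (p i ⊖ p k)
      L-difference {x} x∈L i k = trans
        (·-cong {x = lin G x} {y = q i ⊖ q k} (λ _ → refl) (q-differences i k))
        (isometry {x} {p i ⊖ p k} x∈L (p-differences i k))

      -- The deviation is independent of `i`, as the differences of the `q i` are images of those of
      -- the `p i`. The budget is 8 from Bessel's inequality, 2 times the squared norm 4, plus 4
      -- from `β`: each of the four coordinates has total at most 1 over the disjoint pairs.
      quad-transfer : ∀ {a d b c} (quad : Quad s a d b c) → ∀ i →
          lin G (Quad.vec quad) · q i - Quad.vec quad · p i ≡ 0ℤ
      quad-transfer {a} {d} {b} {c} quad i =
          constant-deviation m≡13 {a = λ k → lin G vec · q k} {λ k → vec · p k} {β} (+ 8) (+ 4)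
        (λ k → constant-difference {lin G vec} {vec} (L-difference vec∈L) k i)
        (λ k → ≤-by _ (0≤* {+ 2} (+≤+ z≤n) (0≤+ (0≤p k b) (0≤p k c)))
            (trans (cong (λ z → β k - z) (vec·p k)) (eq₁ (p k a) (p k d) (p k b) (p k c))))
        (λ k → ≤-by _ (0≤* {+ 2} (+≤+ z≤n) (0≤+ (0≤p k a) (0≤p k d)))
            (trans (cong (λ z → β k - - z) (vec·p k)) (eq₂ (p k a) (p k d) (p k b) (p k c))))
        (subst (λ z → sum (λ k → (lin G vec · q k) * (lin G vec · q k)) ≤ + 2 * z)
          (trans (isometry vec∈L vec∈L) vec·vec) (bessel {k = 1} {q = q} q-orth (lin G vec)))
        (subst (_≤ + 4) (sym sum-β) (ℤ.+-mono-≤ (ℤ.+-mono-≤ (ℤ.+-mono-≤ (Σp≤1 a) (Σp≤1 d)) (Σp≤1 b))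
            (Σp≤1 c)))
        (from-yes (+ 12 ℤ.<? + 13))
        where
        open Quad quad
        Σp≤1 : ∀ k → sum (λ i → p i k) ≤ 1ℤ
        Σp≤1 = sum-p≤1 injective
        β : Vector ℤ m
        β k = p k a + p k d + p k b + p k c
        vec·p : ∀ k → vec · p k ≡ p k a + p k d - p k b - p k c
        vec·p k = trans (·-comm vec (p k)) (·-vec (p k))
        sum-β : sum β ≡ sum (λ k → p k a) + sum (λ k → p k d) + sum (λ k → p k b) + sum (λ k → p k c)
        sum-β = trans (∑-distrib-+ (λ k → p k a + p k d + p k b) (λ k → p k c))
          (cong (λ z → z + sum (λ k → p k c)) (trans (∑-distrib-+ (λ k → p k a + p k d) (λ k → p k b))
            (cong (λ z → z + sum (λ k → p k b)) (∑-distrib-+ (λ k → p k a) (λ k → p k d)))))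
        eq₁ : ∀ a d b c → (a + d + b + c) - (a + d - b - c) ≡ + 2 * (b + c)
        eq₁ = solve-∀
        eq₂ : ∀ a d b c → (a + d + b + c) - - (a + d - b - c) ≡ + 2 * (a + d)
        eq₂ = solve-∀

      -- For fixed `i` the deviation is a linear functional with coefficient vector `γ`. It vanishes
      -- on the vectors of quads, so `γ` is affine in `s` and the functional vanishes on L.
      transfer : ∀ {x} → x ∈L → ∀ i → lin G x · q i ≡ x · p i
      transfer {x} x∈L i = ℤ.i-j≡0⇒i≡j _ _
          (trans (sym (x·γ x)) (affine-annihilates {s = s} {γ} (quad⇒affine spectrum γ γ-quad) {x} x∈L))
        where
        open ≡-Reasoning
        γ : Vector ℤ n
        γ k = G k · q i - p i k
        x·γ : ∀ x → x · γ ≡ lin G x · q i - x · p i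
        x·γ x = trans (·-⊖ʳ x (λ k → G k · q i) (p i)) (cong (λ z → z - x · p i) (sym (lin-· G x (q i))))
        γ-quad : ∀ {a d b c} → Quad s a d b c → γ a + γ d ≡ γ b + γ c
        γ-quad {a} {d} {b} {c} quad = ℤ.i-j≡0⇒i≡j _ _ (begin
          (γ a + γ d) - (γ b + γ c)       ≡⟨ eq (γ a + γ d) (γ b) (γ c) ⟩
          γ a + γ d - γ b - γ c           ≡⟨ sym (trans (·-comm vec γ) (·-vec γ)) ⟩
          vec · γ                         ≡⟨ x·γ vec ⟩
          lin G vec · q i - vec · p i     ≡⟨ quad-transfer quad i ⟩
          0ℤ                              ∎)
          where
          open Quad quad
          eq : ∀ x y z → x - (y + z) ≡ x - y - z
          eq = solve-∀

    private
      module F  = Frame pairs₄₉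
      module F′ = Frame pairs₅₀
      module ₄₉ = Pairs pairs₄₉
      module ₅₀ = Pairs pairs₅₀

    -- The two centres were found independently, so the mutual position of the two simplices needs
    -- its own argument. `transfer` for the sum 50 makes the deviation independent of `i`; the
    -- budget is now 2 * 2 + 2 = 6 < 13.
    cross-transfer : ∀ i k → F.q i · F′.q k ≡ ₄₉.p i · ₅₀.p k
    cross-transfer i k = trans (·-comm (F.q i) (F′.q k)) (trans (ℤ.i-j≡0⇒i≡j _ _
      (constant-deviation m≡13 {a = λ l → F′.q k · F.q l} {λ l → ₅₀.p k · ₄₉.p l} {λ l → ₅₀.p k · ₄₉.p l}
          (+ 4) (+ 2)
        (λ l → F.constant-difference {F′.q k} {₅₀.p k} same l i)
        (λ l → ℤ.≤-refl)
        (λ l → ℤ.≤-trans (ℤ.neg-mono-≤ (0≤p·p l)) (0≤p·p l))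
        (subst (λ z → sum (λ l → (F′.q k · F.q l) * (F′.q k · F.q l)) ≤ + 2 * z)
          (trans (F′.q-orth k k) (cong (+ 2 *_) (δ-refl k))) (bessel {k = 1} {q = F.q} F.q-orth (F′.q k)))
        (subst (_≤ + 2) (sym (sum-β))
          (ℤ.+-mono-≤ (₄₉.sum-p≤1 injective (₅₀.a k)) (₄₉.sum-p≤1 injective (₅₀.b k))))
        (from-yes (+ 6 ℤ.<? + 13)))) (·-comm (₅₀.p k) (₄₉.p i)))
      where
      same : ∀ i l → F′.q k · (F.q i ⊖ F.q l) ≡ ₅₀.p k · (₄₉.p i ⊖ ₄₉.p l)
      same i l = trans (·-comm (F′.q k) (F.q i ⊖ F.q l))
        (trans (·-cong {x = F.q i ⊖ F.q l} {y = F′.q k} (F.q-differences i l) (λ _ → refl))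
        (trans (F′.transfer (F.p-differences i l) k) (·-comm (₄₉.p i ⊖ ₄₉.p l) (₅₀.p k))))
      p·p : ∀ l → ₅₀.p k · ₄₉.p l ≡ ₄₉.p l (₅₀.a k) + ₄₉.p l (₅₀.b k)
      p·p l = trans (·-comm (₅₀.p k) (₄₉.p l)) (₅₀.·-p (₄₉.p l) k)
      0≤p·p : ∀ l → 0ℤ ≤ ₅₀.p k · ₄₉.p l
      0≤p·p l = subst (0ℤ ≤_) (sym (p·p l)) (0≤+ (₄₉.0≤p l (₅₀.a k)) (₄₉.0≤p l (₅₀.b k)))
      sum-β : sum (λ l → ₅₀.p k · ₄₉.p l) ≡ sum (λ l → ₄₉.p l (₅₀.a k)) + sum (λ l → ₄₉.p l (₅₀.b k))
      sum-β = trans (sum-cong-≗ p·p) (∑-distrib-+ (λ l → ₄₉.p l (₅₀.a k)) (λ l → ₄₉.p l (₅₀.b k)))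

  parity : ∀ a → ∃ λ h → a ≡ + 2 * h ⊎ a ≡ + 2 * h + 1ℤ
  parity a with a ℤ.%ℕ 2 | ℤ.n%ℕd<d a 2 | ℤ.a≡a%ℕn+[a/ℕn]*n a 2
  ... | 0 | _ | eq = a ℤ./ℕ 2 , inj₁ (trans eq (trans (ℤ.+-identityˡ _) (ℤ.*-comm (a ℤ./ℕ 2) (+ 2))))
  ... | 1 | _ | eq = a ℤ./ℕ 2 , inj₂
      (trans eq (trans (ℤ.+-comm 1ℤ (a ℤ./ℕ 2 * + 2)) (cong (λ z → z + 1ℤ) (ℤ.*-comm (a ℤ./ℕ 2) (+ 2)))))
  ... | suc (suc _) | s≤s (s≤s ()) | _

  -- If c j were odd, all n coordinates f i j would be odd, against Bessel's
  -- inequality for the j-th unit vector.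
  even-offset : {f K : Fin n → Vector ℤ N} {c : Vector ℤ N} → 5 ℕ.≤ n → Orthogonal (+ 4) f →
                (∀ i j → f i j ≡ + 2 * K i j - c j) → ∀ j → ∃ λ h → c j ≡ + 2 * h
  even-offset {n} {f = f} {K} {c} 5≤n f-orth f≡2K-c j = go (parity (c j))
    where
    open ℤ.≤-Reasoning
    odd-square : ∀ a h → 1ℤ ≤ (+ 2 * a - (+ 2 * h + 1ℤ)) * (+ 2 * a - (+ 2 * h + 1ℤ))
    odd-square a h = ≤-by (+ 4 * ((a - h) * (a - h) - (a - h))) (0≤* {+ 4} (+≤+ z≤n) (0≤i*i-i (a - h)))
        (eq a h)
      where
      eq : ∀ a h → (+ 2 * a - (+ 2 * h + 1ℤ)) * (+ 2 * a - (+ 2 * h + 1ℤ)) - 1ℤ ≡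
          + 4 * ((a - h) * (a - h) - (a - h))
      eq = solve-∀
    go : (∃ λ h → c j ≡ + 2 * h ⊎ c j ≡ + 2 * h + 1ℤ) → ∃ λ h → c j ≡ + 2 * h
    go (h , inj₁ even) = h , even
    go (h , inj₂ odd) = contradiction 5≤n (ℕ.<⇒≱ (s≤s (ℤ.drop‿+≤+ (begin
      + n                                            ≡⟨ sym (trans (sum-const n 1ℤ) (ℤ.*-identityʳ (+ n))) ⟩
      sum {n} (λ _ → 1ℤ)                             ≤⟨ sum-mono {g = λ i → (δ j · f i) * (δ j · f i)}
          odd-squares ⟩
      sum (λ i → (δ j · f i) * (δ j · f i))          ≤⟨ bessel {k = 3} {q = f} f-orth (δ j) ⟩
      + 4 * (δ j · δ j)                              ≡⟨ cong (+ 4 *_) (trans (·-δˡ j (δ j)) (δ-refl j)) ⟩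
      + 4                                            ∎))))
      where
      odd-squares : ∀ i → 1ℤ ≤ (δ j · f i) * (δ j · f i)
      odd-squares i = subst (λ a → 1ℤ ≤ a * a)
        (sym (trans (·-δˡ j (f i)) (trans (f≡2K-c i j) (cong (λ a → + 2 * K i j - a) odd))))
        (odd-square (K i j) h)

  module _ {s : Fin n → ℕ} (5≤n : 5 ℕ.≤ n) (m≡13 : m ≡ 13) (spectrum : Spectrum s m)
      (embedding : Embedding {n} {N} s) where
    open Spectrum spectrum
    open Embedding embedding

    private
      module F  = Frame m≡13 spectrum embedding pairs₄₉
      module F′ = Frame m≡13 spectrum embedding pairs₅₀
      module ₄₉ = Pairs pairs₄₉
      module ₅₀ = Pairs pairs₅₀

      w : Vector ℤ n
      w i = + s i

      o : Fin m
      o = subst Fin (sym m≡13) zero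

      p p′ : Vector ℤ n
      p  = ₄₉.p o
      p′ = ₅₀.p o

      q q′ c c′ : Vector ℤ N
      q  = F.q o
      q′ = F′.q o
      c  = F.c
      c′ = F′.c

      -- The solution of λ + μ = 1 and 49 λ + 50 μ = 2 `w i`: with these coefficients `p` and `p′`
      -- account for both the coordinate sum and the weighted sum of twice the i-th unit vector.
      λ₄₉ μ₅₀ : Fin n → ℤ
      λ₄₉ i = + 50 - + 2 * w i
      μ₅₀ i = + 2 * w i - + 49

      -- The component in L of twice the i-th unit vector.
      x : Fin n → Vector ℤ n
      x i = + 2 ⊛ δ i ⊖ λ₄₉ i ⊛ p ⊖ μ₅₀ i ⊛ p′

      e : Fin n → Vector ℤ n
      e i = x i ⊕ λ₄₉ i ⊛ p ⊕ μ₅₀ i ⊛ p′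

      X f : Fin n → Vector ℤ N
      X i = lin G (x i)
      f i = X i ⊕ λ₄₉ i ⊛ q ⊕ μ₅₀ i ⊛ q′

      ·-x : ∀ u i → u · x i ≡ + 2 * u i - λ₄₉ i * (u · p) - μ₅₀ i * (u · p′)
      ·-x u i = trans (·-⊖ʳ u (+ 2 ⊛ δ i ⊖ λ₄₉ i ⊛ p) (μ₅₀ i ⊛ p′)) (cong₂ _-_
        (trans (·-⊖ʳ u (+ 2 ⊛ δ i) (λ₄₉ i ⊛ p)) (cong₂ _-_
          (trans (·-⊛ʳ (+ 2) u (δ i)) (cong (+ 2 *_) (·-δʳ u i)))
          (·-⊛ʳ (λ₄₉ i) u p)))
        (·-⊛ʳ (μ₅₀ i) u p′))

      x∈L : ∀ i → InL s (x i)
      x∈L i =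
        trans (·-x 𝟏 i) (trans (cong₂ (λ a b → + 2 * 1ℤ - λ₄₉ i * a - μ₅₀ i * b) (F.𝟏·p o) (F′.𝟏·p o))
            (eq₁ (w i))) ,
        trans (·-x w i) (trans (cong₂ (λ a b → + 2 * w i - λ₄₉ i * a - μ₅₀ i * b) (F.w·p o) (F′.w·p o))
            (eq₂ (w i)))
        where
        eq₁ : ∀ w → + 2 * 1ℤ - (+ 50 - + 2 * w) * + 2 - (+ 2 * w - + 49) * + 2 ≡ 0ℤ
        eq₁ = solve-∀
        eq₂ : ∀ w → + 2 * w - (+ 50 - + 2 * w) * + 49 - (+ 2 * w - + 49) * + 50 ≡ 0ℤ
        eq₂ = solve-∀

      e≗2δ : ∀ i → e i ≗ + 2 ⊛ δ i
      e≗2δ i j = eq (+ 2 * δ i j) (λ₄₉ i * p j) (μ₅₀ i * p′ j)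
        where
        eq : ∀ a b c → a - b - c + b + c ≡ a
        eq = solve-∀

      e·e : ∀ i k → e i · e k ≡ + 4 * δ i k
      e·e i k = begin
        e i · e k                          ≡⟨ ·-cong {x = e i} {y = e k} (e≗2δ i) (e≗2δ k) ⟩
        (+ 2 ⊛ δ i) · (+ 2 ⊛ δ k)          ≡⟨ ·-⊛ˡ (+ 2) (δ i) (+ 2 ⊛ δ k) ⟩
        + 2 * (δ i · (+ 2 ⊛ δ k))          ≡⟨ cong (+ 2 *_)
            (trans (·-⊛ʳ (+ 2) (δ i) (δ k)) (cong (+ 2 *_) (·-δʳ (δ i) k))) ⟩
        + 2 * (+ 2 * δ i k)                ≡⟨ sym (ℤ.*-assoc (+ 2) (+ 2) (δ i k)) ⟩
        + 4 * δ i k                        ∎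
        where open ≡-Reasoning

      ·-comb : ∀ {l} (u x y z : Vector ℤ l) a b → u · (x ⊕ a ⊛ y ⊕ b ⊛ z) ≡
          u · x + a * (u · y) + b * (u · z)
      ·-comb u x y z a b = trans (·-⊕ʳ u (x ⊕ a ⊛ y) (b ⊛ z))
        (cong₂ _+_ (trans (·-⊕ʳ u x (a ⊛ y)) (cong (λ t → u · x + t) (·-⊛ʳ a u y))) (·-⊛ʳ b u z))

      -- The vectors `f k` and `e k` are the same combination of corresponding vectors, so an inner
      -- product with them is determined by three others. Used with `X k`, `q`, `q′` and finally
      -- `f i` as `u`, it turns all the transfer results into the Gram matrix of `f`.
      f-transfer : ∀ u u′ k → u · X k ≡ u′ · x k → u · q ≡ u′ · p → u · q′ ≡ u′ · p′ → u · f k ≡ u′ · e k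
      f-transfer u u′ k eqx eqp eqp′ = begin
        u · f k
          ≡⟨ ·-comb u (X k) q q′ (λ₄₉ k) (μ₅₀ k) ⟩
        u · X k + λ₄₉ k * (u · q) + μ₅₀ k * (u · q′)
          ≡⟨ cong₂ _+_ (cong₂ _+_ eqx (cong (λ₄₉ k *_) eqp)) (cong (μ₅₀ k *_) eqp′) ⟩
        u′ · x k + λ₄₉ k * (u′ · p) + μ₅₀ k * (u′ · p′)
          ≡⟨ sym (·-comb u′ (x k) p p′ (λ₄₉ k) (μ₅₀ k)) ⟩
        u′ · e k ∎
        where open ≡-Reasoning

      commute : ∀ {l l′} {u v : Vector ℤ l} {u′ v′ : Vector ℤ l′} → u · v ≡ u′ · v′ → v · u ≡ v′ · u′
      commute {u = u} {v} {u′} {v′} eq = trans (·-comm v u) (trans eq (·-comm u′ v′))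

      X·q : ∀ i → X i · q ≡ x i · p
      X·q i = F.transfer {x i} (x∈L i) o

      X·q′ : ∀ i → X i · q′ ≡ x i · p′
      X·q′ i = F′.transfer {x i} (x∈L i) o

      q·q′ : q · q′ ≡ p · p′
      q·q′ = cross-transfer m≡13 spectrum embedding o o

      q·q : q · q ≡ p · p
      q·q = trans (F.q-orth o o) (sym (F.p-orth o o))

      q′·q′ : q′ · q′ ≡ p′ · p′
      q′·q′ = trans (F′.q-orth o o) (sym (F′.p-orth o o))

      f-orth : Orthogonal (+ 4) f
      f-orth i k = trans (f-transfer (f i) (e i) k
        (commute {u = X k} {f i} {x k} {e i}
            (f-transfer (X k) (x k) i (isometry {x k} {x i} (x∈L k) (x∈L i)) (X·q k) (X·q′ k)))
        (commute {u = q} {f i} {p} {e i}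
            (f-transfer q p i (commute {u = X i} {q} {x i} {p} (X·q i)) q·q q·q′))
        (commute {u = q′} {f i} {p′} {e i}
            (f-transfer q′ p′ i (commute {u = X i} {q′} {x i} {p′} (X·q′ i))
            (commute {u = q} {q′} {p} {p′} q·q′) q′·q′)))
        (e·e i k)

      -- Expanding `f i` leaves twice the i-th vector of `G` minus `λ₄₉ i` times `c` and `μ₅₀ i`
      -- times `c′`. The first coefficient is even and the second odd for every `i`, so modulo 2 all
      -- `f i` agree with the single vector `c′`; `K` is half of the remaining even part.
      K : Fin n → Vector ℤ N
      K i j = G i j + (w i - + 25) * (c j - c′ j)

      f≡2K-c′ : ∀ i j → f i j ≡ + 2 * K i j - c′ j
      f≡2K-c′ i j = trans
        (cong (λ a → a + λ₄₉ i * q j + μ₅₀ i * q′ j)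
            (trans (·-comm (x i) (λ k → G k j)) (trans (·-x (λ k → G k j) i)
          (cong₂ (λ a b → + 2 * G i j - λ₄₉ i * a - μ₅₀ i * b) (·-comm (λ k → G k j) p)
              (·-comm (λ k → G k j) p′)))))
        (eq (G i j) (w i) (F.P o j) (F′.P o j) (c j) (c′ j))
        where
        eq : ∀ g w P P′ c c′ →
             + 2 * g - (+ 50 - + 2 * w) * P - (+ 2 * w - + 49) * P′ + (+ 50 - + 2 * w) * (P - c) +
                 (+ 2 * w - + 49) * (P′ - c′)
             ≡ + 2 * (g + (w - + 25) * (c - c′)) - c′
        eq = solve-∀

      h : Vector ℤ N
      h j = proj₁ (even-offset {f = f} {K} {c′} 5≤n f-orth f≡2K-c′ j)

    -- As `c′` is even, `f i` is twice an integral vector `E i`, the corrected image of the i-th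
    -- unit vector. In each coordinate `E` differs from `G` by an affine function of `s`, which L
    -- annihilates, so the correction is invisible on L.
    orthonormal-extension : ∃ λ (E : Fin n → Vector ℤ N) →
      Orthogonal 1ℤ E × (∀ {x} → InL s x → lin G x ≗ lin E x)
    orthonormal-extension = E , orth , λ {y} → agree {y}
      where
      open ≡-Reasoning
      E : Fin n → Vector ℤ N
      E i j = K i j - h j
      f≗2E : ∀ i → f i ≗ + 2 ⊛ E i
      f≗2E i j = trans (f≡2K-c′ i j)
          (trans (cong (λ a → + 2 * K i j - a) (proj₂ (even-offset {f = f} {K} {c′} 5≤n f-orth f≡2K-c′ j)))
          (eq (K i j) (h j)))
        where
        eq : ∀ a b → + 2 * a - + 2 * b ≡ + 2 * (a - b)
        eq = solve-∀
      orth : Orthogonal 1ℤ E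
      orth i k = ℤ.*-cancelˡ-≡ (+ 4) _ _ (begin
        + 4 * (E i · E k)              ≡⟨ ℤ.*-assoc (+ 2) (+ 2) (E i · E k) ⟩
        + 2 * (+ 2 * (E i · E k))      ≡⟨ sym
            (trans (·-⊛ˡ (+ 2) (E i) (+ 2 ⊛ E k)) (cong (+ 2 *_) (·-⊛ʳ (+ 2) (E i) (E k)))) ⟩
        (+ 2 ⊛ E i) · (+ 2 ⊛ E k)      ≡⟨ sym (·-cong {x = f i} {y = f k} (f≗2E i) (f≗2E k)) ⟩
        f i · f k                      ≡⟨ f-orth i k ⟩
        + 4 * δ i k                    ≡⟨ cong (+ 4 *_) (sym (ℤ.*-identityˡ (δ i k))) ⟩
        + 4 * (1ℤ * δ i k)             ∎)
      agree : ∀ {y} → InL s y → lin G y ≗ lin E y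
      agree {y} y∈L j = begin
        lin G y j
          ≡⟨ sym (ℤ.+-identityʳ (lin G y j)) ⟩
        lin G y j + 0ℤ
          ≡⟨ cong (λ a → lin G y j + a) (sym (affine-annihilates {s = s} {λ i → E i j - G i j}
               (- (+ 25) * (c j - c′ j) - h j , c j - c′ j , λ i → eq₁ (G i j) (w i) (c j - c′ j) (h j))
                   {y} y∈L)) ⟩
        lin G y j + y · (λ i → E i j - G i j)
          ≡⟨ sym (·-⊕ʳ y (λ i → G i j) (λ i → E i j - G i j)) ⟩
        y · (λ i → G i j + (E i j - G i j))
          ≡⟨ ·-cong {x = y} (λ _ → refl) (λ i → eq₂ (G i j) (E i j)) ⟩
        lin E y j ∎
        where
        eq₁ : ∀ g w d h → (g + (w - + 25) * d - h) - g ≡ (- (+ 25) * d - h) + d * w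
        eq₁ = solve-∀
        eq₂ : ∀ a b → a + (b - a) ≡ b
        eq₂ = solve-∀

  -- Orthonormal systems as signed permutations

  IsSign : ℤ → Set
  IsSign ε = ε ≡ 1ℤ ⊎ ε ≡ - 1ℤ

  sign² : ∀ {ε} → IsSign ε → ε * ε ≡ 1ℤ
  sign² (inj₁ refl) = refl
  sign² (inj₂ refl) = refl

  x·x≡0⇒x≗0 : (x : Vector ℤ n) → x · x ≡ 0ℤ → ∀ i → x i ≡ 0ℤ
  x·x≡0⇒x≗0 x x·x≡0 i = zero-square (x i)
      (subst (x i * x i ≤_) x·x≡0 (term≤sum {f = λ k → x k * x k} (λ k → 0≤i*i (x k)) i))
    where
    zero-square : ∀ a → a * a ≤ 0ℤ → a ≡ 0ℤ
    zero-square (+ 0) _ = refl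
    zero-square +[1+ _ ] (+≤+ ())
    zero-square -[1+ _ ] (+≤+ ())

  -- The squares of the integer entries sum to 1, so exactly one entry is 1 or -1. The result is
  -- given as the evaluation of all functionals, the form in which the signed permutation is applied
  -- later.
  unit-vector : (x : Vector ℤ n) → x · x ≡ 1ℤ → ∃ λ π → ∃ λ ε → IsSign ε × (∀ f → f · x ≡ ε * f π)
  unit-vector {zero} x ()
  unit-vector {suc n} x x·x≡1 = go
      (i*i≤2 (x zero) (ℤ.≤-trans (term≤sum {f = λ k → x k * x k} (λ k → 0≤i*i (x k)) zero)
                                                      (ℤ.≤-trans (ℤ.≤-reflexive x·x≡1) (+≤+ (s≤s z≤n)))))
    where
    open ≡-Reasoning
    x⁺ : Vector ℤ n
    x⁺ = x ∘ suc
    concentrated : IsSign (x zero) → ∀ f → f · x ≡ x zero * f zero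
    concentrated ε f = begin
      f zero * x zero + (f ∘ suc) · x⁺
        ≡⟨ cong₂ _+_ (ℤ.*-comm (f zero) (x zero))
            (sum-zero (λ i → trans (cong (f (suc i) *_) (x·x≡0⇒x≗0 x⁺ rest i)) (ℤ.*-zeroʳ (f (suc i))))) ⟩
      x zero * f zero + 0ℤ
        ≡⟨ ℤ.+-identityʳ _ ⟩
      x zero * f zero ∎
      where
      eq : ∀ a b → b ≡ (a + b) - a
      eq = solve-∀
      rest : x⁺ · x⁺ ≡ 0ℤ
      rest = trans (eq (x zero * x zero) (x⁺ · x⁺)) (cong₂ _-_ x·x≡1 (sign² ε))
    go : x zero ≡ 0ℤ ⊎ x zero ≡ 1ℤ ⊎ x zero ≡ - 1ℤ → ∃ λ π → ∃ λ ε → IsSign ε × (∀ f → f · x ≡ ε * f π)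
    go (inj₂ ε) = zero , x zero , ε , concentrated ε
    go (inj₁ x₀≡0) with unit-vector x⁺
        (trans (sym (trans (cong (λ a → a * a + x⁺ · x⁺) x₀≡0) (ℤ.+-identityˡ (x⁺ · x⁺)))) x·x≡1)
    ... | π , ε , sgn , eval = suc π , ε , sgn , λ f → trans
      (cong₂ _+_ (trans (cong (f zero *_) x₀≡0) (ℤ.*-zeroʳ (f zero))) (eval (f ∘ suc)))
      (ℤ.+-identityˡ (ε * f (suc π)))

  Increasing : (Fin n → ℕ) → Set
  Increasing s = ∀ {i j} → i Fin.< j → s i ℕ.< s j

  increasing⇒toℕ≤ : (f : Fin n → Fin N) → Increasing (Fin.toℕ ∘ f) → ∀ i → Fin.toℕ i ℕ.≤ Fin.toℕ (f i)
  increasing⇒toℕ≤ {suc n} f incr = Fin.<-weakInduction (λ i → Fin.toℕ i ℕ.≤ Fin.toℕ (f i)) z≤n step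
    where
    step : ∀ i → Fin.toℕ (Fin.inject₁ i) ℕ.≤ Fin.toℕ (f (Fin.inject₁ i)) →
        suc (Fin.toℕ i) ℕ.≤ Fin.toℕ (f (suc i))
    step i ih = ℕ.≤-<-trans (subst (ℕ._≤ Fin.toℕ (f (Fin.inject₁ i))) (Fin.toℕ-inject₁ i) ih)
                  (incr (s≤s (ℕ.≤-reflexive (Fin.toℕ-inject₁ i))))

  opposite-< : {i j : Fin n} → i Fin.< j → Fin.opposite j Fin.< Fin.opposite i
  opposite-< {n} {i} {j} i<j = subst₂ ℕ._<_ (sym (Fin.opposite-prop j)) (sym (Fin.opposite-prop i))
    (ℕ.∸-monoʳ-< (s≤s i<j) (Fin.toℕ<n j))

  -- An increasing map never lowers an index. Conjugated by `Fin.opposite`, the same bound says that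
  -- it never raises one.
  increasing⇒id : (f : Fin n → Fin n) → Increasing (Fin.toℕ ∘ f) → ∀ i → f i ≡ i
  increasing⇒id f incr i = Fin.toℕ-injective (ℕ.≤-antisym (ℕ.≮⇒≥ not-above) (increasing⇒toℕ≤ f incr i))
    where
    not-above : ¬ (i Fin.< f i)
    not-above i<fi = ℕ.<⇒≱ (opposite-< i<fi)
        (subst (λ k → Fin.toℕ (Fin.opposite i) ℕ.≤ Fin.toℕ (Fin.opposite (f k))) (Fin.opposite-involutive i)
      (increasing⇒toℕ≤ (λ k → Fin.opposite (f (Fin.opposite k)))
          (λ j<k → opposite-< (incr (opposite-< j<k))) (Fin.opposite i)))

  increasing-reflects : {s : Fin n → ℕ} → Increasing s → ∀ {i j} → s i ℕ.< s j → i Fin.< j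
  increasing-reflects {s = s} incr {i} {j} si<sj with Fin.<-cmp i j
  ... | tri< i<j _ _ = i<j
  ... | tri≈ _ i≡j _ = contradiction si<sj (ℕ.<-irrefl (cong s i≡j))
  ... | tri> _ _ j<i = contradiction si<sj (ℕ.<-asym (incr j<i))

  toℕ<s : {s : Fin n → ℕ} → Increasing s → (∀ j → 1 ℕ.≤ s j) → ∀ i → Fin.toℕ i ℕ.< s i
  toℕ<s {suc n} {s} incr positive = Fin.<-weakInduction (λ i → Fin.toℕ i ℕ.< s i) (positive zero) step
    where
    step : ∀ i → Fin.toℕ (Fin.inject₁ i) ℕ.< s (Fin.inject₁ i) → suc (Fin.toℕ i) ℕ.< s (suc i)
    step i ih = ℕ.≤-<-trans (subst (ℕ._< s (Fin.inject₁ i)) (Fin.toℕ-inject₁ i) ih)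
                  (incr (s≤s (ℕ.≤-reflexive (Fin.toℕ-inject₁ i))))

  module _ {s s′ : Fin n → ℕ} (incr : Increasing s) (incr′ : Increasing s′)
           (spectrum : Spectrum s m) (spectrum′ : Spectrum s′ m)
           {l l⁻ : Fin n} (last : suc (Fin.toℕ l) ≡ n) (last⁻ : suc (suc (Fin.toℕ l⁻)) ≡ n)
               (gap : s l ≡ 2 ℕ.+ s l⁻)
           (E : Fin n → Vector ℤ n) (E-orth : Orthogonal 1ℤ E)
           (image : ∀ {x} → InL s x → InL s′ (lin E x)) where

    private
      module S  = Spectrum spectrum
      module S′ = Spectrum spectrum′

      unit : ∀ i → ∃ λ π → ∃ λ ε → IsSign ε × (∀ f → f · E i ≡ ε * f π)
      unit i = unit-vector (E i) (trans (E-orth i i) (trans (ℤ.*-identityˡ (δ i i)) (δ-refl i)))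

      π : Fin n → Fin n
      π i = proj₁ (unit i)

      ε : Fin n → ℤ
      ε i = proj₁ (proj₂ (unit i))

      ε-sign : ∀ i → IsSign (ε i)
      ε-sign i = proj₁ (proj₂ (proj₂ (unit i)))

      eval : ∀ i f → f · E i ≡ ε i * f (π i)
      eval i = proj₂ (proj₂ (proj₂ (unit i)))

      -- A functional that vanishes on the image of L pulls back along `E` to one that vanishes on
      -- quads. It is applied to the two functionals defining L′, whose pullbacks have coefficients
      -- `ε i` and `ε i * s′ (π i)`.
      affine : ∀ f → (∀ {x} → InL s x → f · lin E x ≡ 0ℤ) → ∃ λ A → ∃ λ B → ∀ i → ε i * f (π i) ≡
          A + B * + s i
      affine f vanishes = quad⇒affine spectrum (λ i → ε i * f (π i))
          (λ quad → ℤ.i-j≡0⇒i≡j _ _ (on-quad quad))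
        where
        open ≡-Reasoning
        on-quad : ∀ {a d b c} → Quad s a d b c →
                  (ε a * f (π a) + ε d * f (π d)) - (ε b * f (π b) + ε c * f (π c)) ≡ 0ℤ
        on-quad {a} {d} {b} {c} quad = begin
          (γ a + γ d) - (γ b + γ c)                 ≡⟨ eq (γ a + γ d) (γ b) (γ c) ⟩
          γ a + γ d - γ b - γ c                     ≡⟨ sym (trans (·-comm vec γ) (·-vec γ)) ⟩
          vec · γ                                   ≡⟨ ·-cong {x = vec} (λ _ → refl)
              (λ i → trans (sym (eval i f)) (·-comm f (E i))) ⟩
          vec · (λ i → E i · f)                     ≡⟨ sym (lin-· E vec f) ⟩
          lin E vec · f                             ≡⟨ ·-comm (lin E vec) f ⟩
          f · lin E vec                             ≡⟨ vanishes {vec} vec∈L ⟩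
          0ℤ                                        ∎
          where
          open Quad quad
          γ : Vector ℤ n
          γ i = ε i * f (π i)
          eq : ∀ x y z → x - (y + z) ≡ x - y - z
          eq = solve-∀

      signs-in-progression : ∀ {x y z} → IsSign x → IsSign y → IsSign z → x + z ≡ y + y → x ≡ y
      signs-in-progression (inj₁ refl) (inj₁ refl) _ _ = refl
      signs-in-progression (inj₂ refl) (inj₂ refl) _ _ = refl
      signs-in-progression (inj₁ refl) (inj₂ refl) (inj₁ refl) ()
      signs-in-progression (inj₁ refl) (inj₂ refl) (inj₂ refl) ()
      signs-in-progression (inj₂ refl) (inj₁ refl) (inj₁ refl) ()
      signs-in-progression (inj₂ refl) (inj₁ refl) (inj₂ refl) ()

      -- The signs are an affine function of `s`. At the values 1, 2, 3 they form an arithmetic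
      -- progression within 1 and -1, which must be constant, so the slope is 0.
      ε-constant : ∀ i → ε i ≡ ε (S.ι 1)
      ε-constant i = trans (ε≡A i) (sym (ε≡A (S.ι 1)))
        where
        open ≡-Reasoning
        AB : ∃ λ A → ∃ λ B → ∀ i → ε i * 1ℤ ≡ A + B * + s i
        AB = affine 𝟏 (λ {x} x∈L → proj₁ (image {x} x∈L))
        A B : ℤ
        A = proj₁ AB
        B = proj₁ (proj₂ AB)
        ε≡ : ∀ i → ε i ≡ A + B * + s i
        ε≡ i = trans (sym (ℤ.*-identityʳ (ε i))) (proj₂ (proj₂ AB) i)
        ε≡′ : ∀ {i v} → s i ≡ v → ε i ≡ A + B * + v
        ε≡′ {i} si≡v = trans (ε≡ i) (cong (λ v → A + B * + v) si≡v)
        progression : ε (S.ι 1) + ε (S.ι 3) ≡ ε (S.ι 2) + ε (S.ι 2)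
        progression = trans (cong₂ _+_ (ε≡′ (S.s[ι] 1)) (ε≡′ (S.s[ι] 3)))
            (trans (eq A B) (sym (cong₂ _+_ (ε≡′ (S.s[ι] 2)) (ε≡′ (S.s[ι] 2)))))
          where
          eq : ∀ A B → (A + B * + 1) + (A + B * + 3) ≡ (A + B * + 2) + (A + B * + 2)
          eq = solve-∀
        B≡0 : B ≡ 0ℤ
        B≡0 = begin
          B                                   ≡⟨ eq A B ⟩
          (A + B * + 2) - (A + B * + 1)       ≡⟨ sym (cong₂ _-_ (ε≡′ (S.s[ι] 2)) (ε≡′ (S.s[ι] 1))) ⟩
          ε (S.ι 2) - ε (S.ι 1)                         ≡⟨ cong (λ z → ε (S.ι 2) - z)
              (signs-in-progression (ε-sign (S.ι 1)) (ε-sign (S.ι 2)) (ε-sign (S.ι 3)) progression) ⟩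
          ε (S.ι 2) - ε (S.ι 2)                         ≡⟨ ℤ.+-inverseʳ (ε (S.ι 2)) ⟩
          0ℤ                                  ∎
          where
          eq : ∀ A B → B ≡ (A + B * + 2) - (A + B * + 1)
          eq = solve-∀
        ε≡A : ∀ i → ε i ≡ A
        ε≡A i = trans (ε≡ i) (trans (cong (λ b → A + b * + s i) B≡0) (ℤ.+-identityʳ A))

      s′π-affine : ∃ λ C → ∃ λ D → ∀ i → + s′ (π i) ≡ C + D * + s i
      s′π-affine = η * C , η * D , λ i → begin
        + s′ (π i)                        ≡⟨ sym (ℤ.*-identityˡ _) ⟩
        1ℤ * + s′ (π i)                   ≡⟨ cong (_* + s′ (π i)) (sym (sign² (ε-sign (S.ι 1)))) ⟩
        η * η * + s′ (π i)                ≡⟨ ℤ.*-assoc η η (+ s′ (π i)) ⟩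
        η * (η * + s′ (π i))              ≡⟨ cong (λ z → η * (z * + s′ (π i))) (sym (ε-constant i)) ⟩
        η * (ε i * + s′ (π i))            ≡⟨ cong (η *_) (proj₂ (proj₂ CD) i) ⟩
        η * (C + D * + s i)               ≡⟨ eq η C D (+ s i) ⟩
        η * C + η * D * + s i             ∎
        where
        open ≡-Reasoning
        CD : ∃ λ C → ∃ λ D → ∀ i → ε i * + s′ (π i) ≡ C + D * + s i
        CD = affine (λ j → + s′ j) (λ {x} x∈L → proj₂ (image {x} x∈L))
        C D η : ℤ
        C = proj₁ CD
        D = proj₁ (proj₂ CD)
        η = ε (S.ι 1)
        eq : ∀ η C D w → η * (C + D * w) ≡ η * C + η * D * w
        eq = solve-∀

      π-injective : ∀ {i k} → π i ≡ π k → i ≡ k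
      π-injective {i} {k} πi≡πk with i Fin.≟ k
      ... | yes i≡k = i≡k
      ... | no i≢k = contradiction E·E (sign*sign≢0 (ε-sign k) (ε-sign i))
        where
        open ≡-Reasoning
        sign*sign≢0 : ∀ {x y} → IsSign x → IsSign y → x * y ≢ 0ℤ
        sign*sign≢0 (inj₁ refl) (inj₁ refl) ()
        sign*sign≢0 (inj₁ refl) (inj₂ refl) ()
        sign*sign≢0 (inj₂ refl) (inj₁ refl) ()
        sign*sign≢0 (inj₂ refl) (inj₂ refl) ()
        E·E : ε k * ε i ≡ 0ℤ
        E·E = begin
          ε k * ε i               ≡⟨ cong (ε k *_)
              (sym (trans (cong (ε i *_) (trans (cong (δ (π k)) πi≡πk) (δ-refl (π k))))
              (ℤ.*-identityʳ (ε i)))) ⟩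
          ε k * (ε i * δ (π k) (π i)) ≡⟨ cong (ε k *_) (sym (eval i (δ (π k)))) ⟩
          ε k * (δ (π k) · E i)   ≡⟨ cong (ε k *_) (·-δˡ (π k) (E i)) ⟩
          ε k * E i (π k)         ≡⟨ sym (eval k (E i)) ⟩
          E i · E k               ≡⟨ E-orth i k ⟩
          1ℤ * δ i k              ≡⟨ cong (1ℤ *_) (δ-≢ i≢k) ⟩
          0ℤ                      ∎

      first : ∀ {t : Fin n → ℕ} → Increasing t → (∀ j → 1 ℕ.≤ t j) → ∀ {j} → t j ≡ 1 → Fin.toℕ j ≡ 0
      first incr pos {j} tj≡1 = ℕ.n≤0⇒n≡0 (ℕ.≤-pred (subst (Fin.toℕ j ℕ.<_) tj≡1 (toℕ<s incr pos j)))

      second : ∀ {t : Fin n → ℕ} → Increasing t → (∀ j → 1 ℕ.≤ t j) → ∀ {i j} → t i ≡ 1 → t j ≡ 2 →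
          Fin.toℕ j ≡ 1
      second incr pos {i} {j} ti≡1 tj≡2 =
          ℕ.≤-antisym (ℕ.≤-pred (subst (Fin.toℕ j ℕ.<_) tj≡2 (toℕ<s incr pos j)))
        (ℕ.≤-<-trans z≤n (increasing-reflects incr {i} {j} (subst₂ ℕ._<_ (sym ti≡1) (sym tj≡2) ℕ.≤-refl)))

      C D : ℤ
      C = proj₁ s′π-affine
      D = proj₁ (proj₂ s′π-affine)

      s′π : ∀ i → + s′ (π i) ≡ C + D * + s i
      s′π = proj₂ (proj₂ s′π-affine)

      at : ∀ {i j v v′} → π i ≡ j → s i ≡ v → s′ j ≡ v′ → + v′ ≡ C + D * + v
      at {i} refl refl refl = s′π i

      increasing-case : (∀ i → π i ≡ i) → ∀ i → s i ≡ s′ i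
      increasing-case π≡id i = sym (ℤ.+-injective (begin
        + s′ i                           ≡⟨ at (π≡id i) refl refl ⟩
        C + D * + s i                    ≡⟨ cong₂ (λ c d → c + d * + s i) C≡0 D≡1 ⟩
        0ℤ + 1ℤ * + s i                  ≡⟨ trans (ℤ.+-identityˡ _) (ℤ.*-identityˡ _) ⟩
        + s i                            ∎))
        where
        open ≡-Reasoning
        first≡ : π (S.ι 1) ≡ (S′.ι 1)
        first≡ = trans (π≡id (S.ι 1)) (Fin.toℕ-injective
            (trans (first incr S.positive (S.s[ι] 1)) (sym (first incr′ S′.positive (S′.s[ι] 1)))))
        second≡ : π (S.ι 2) ≡ (S′.ι 2)
        second≡ = trans (π≡id (S.ι 2))
            (Fin.toℕ-injective (trans (second incr S.positive (S.s[ι] 1) (S.s[ι] 2))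
            (sym (second incr′ S′.positive (S′.s[ι] 1) (S′.s[ι] 2)))))
        D≡1 : D ≡ 1ℤ
        D≡1 = trans (eq C D) (sym (cong₂ _-_ (at second≡ (S.s[ι] 2) (S′.s[ι] 2))
            (at first≡ (S.s[ι] 1) (S′.s[ι] 1))))
          where
          eq : ∀ C D → D ≡ (C + D * + 2) - (C + D * + 1)
          eq = solve-∀
        C≡0 : C ≡ 0ℤ
        C≡0 = trans (eq C D) (cong₂ _-_ (sym (at first≡ (S.s[ι] 1) (S′.s[ι] 1))) D≡1)
          where
          eq : ∀ C D → C ≡ (C + D * + 1) - D
          eq = solve-∀

      -- Reversal would map the gap of 2 at the top of s onto the gap of 1 at the
      -- bottom of s′.
      decreasing-case : ¬ (∀ i → π i ≡ Fin.opposite i)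
      decreasing-case π≡opposite = 2*i≢-1 D (trans (eq C D (+ s l⁻))
        (sym (cong₂ _-_ (at first≡ gap (S′.s[ι] 1)) (at second≡ refl (S′.s[ι] 2)))))
        where
        open ≡-Reasoning
        first≡ : π l ≡ (S′.ι 1)
        first≡ = trans (π≡opposite l) (Fin.toℕ-injective (trans (Fin.opposite-prop l)
          (trans (cong (n ℕ.∸_) last) (trans (ℕ.n∸n≡0 n) (sym (first incr′ S′.positive (S′.s[ι] 1)))))))
        second≡ : π l⁻ ≡ (S′.ι 2)
        second≡ = trans (π≡opposite l⁻) (Fin.toℕ-injective (trans (Fin.opposite-prop l⁻)
          (trans (cong (ℕ._∸ suc (Fin.toℕ l⁻)) (sym last⁻))
              (trans (ℕ.m+n∸n≡m 1 (suc (Fin.toℕ l⁻)))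
              (sym (second incr′ S′.positive (S′.s[ι] 1) (S′.s[ι] 2)))))))
        eq : ∀ C D w → + 2 * D ≡ (C + D * (+ 2 + w)) - (C + D * w)
        eq = solve-∀
        2*i≢-1 : ∀ i → + 2 * i ≢ - 1ℤ
        2*i≢-1 (+ zero) ()
        2*i≢-1 +[1+ _ ] ()
        2*i≢-1 -[1+ zero ] ()
        2*i≢-1 -[1+ suc _ ] ()

    -- The slope `D` of `s′ (π i)` over `s i` decides: positive makes `π` the identity, negative
    -- makes it the reversal, and zero contradicts injectivity.
    isometry⇒≗ : ∀ i → s i ≡ s′ i
    isometry⇒≗ with ℤ.<-cmp 0ℤ D
    ... | tri< 0<D _ _ = increasing-case (increasing⇒id π mono)
      where
      mono : Increasing (Fin.toℕ ∘ π)
      mono {i} {j} i<j = increasing-reflects incr′ (ℤ.drop‿+<+ (subst₂ _<_ (sym (s′π i)) (sym (s′π j))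
        (ℤ.+-monoʳ-< C (ℤ.*-monoˡ-<-pos D {{ℤ.positive 0<D}} (+<+ (incr i<j))))))
    ... | tri≈ _ 0≡D _ = contradiction
      (trans (sym (S.s[ι] 1)) (trans (cong s (π-injective (Spectrum.injective spectrum′ (ℤ.+-injective
        (trans (s′π (S.ι 1)) (trans (trans (cong (λ d → C + d * + s (S.ι 1)) (sym 0≡D))
            (cong (λ d → C + d * + s (S.ι 2)) 0≡D)) (sym (s′π (S.ι 2))))))))) (S.s[ι] 2)))
      (λ ())
    ... | tri> _ _ D<0 = contradiction
      (λ i → trans (sym (Fin.opposite-involutive (π i)))
          (cong Fin.opposite (increasing⇒id (Fin.opposite ∘ π) anti i)))
      decreasing-case
      where
      anti : Increasing (Fin.toℕ ∘ Fin.opposite ∘ π)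
      anti {i} {j} i<j = opposite-< (increasing-reflects incr′
          (ℤ.drop‿+<+ (subst₂ _<_ (sym (s′π j)) (sym (s′π i))
        (ℤ.+-monoʳ-< C (ℤ.*-monoˡ-<-neg D {{ℤ.negative D<0}} (+<+ (incr i<j)))))))

  -- Linearity of isometries

  module _ {s : Fin n → ℕ} where

    ∈L-cong : ∀ {x y} → x ≗ y → InL s x → InL s y
    ∈L-cong {x} {y} x≗y (p , q) = trans (·-cong {x = 𝟏} {y = y} (λ _ → refl) (λ i → sym (x≗y i))) p ,
                          trans (·-cong {x = λ i → + s i} {y = y} (λ _ → refl) (λ i → sym (x≗y i))) q

    ∈L-⊕ : ∀ {x y} → InL s x → InL s y → InL s (x ⊕ y)
    ∈L-⊕ {x} {y} (p , q) (p′ , q′) = trans (·-⊕ʳ 𝟏 x y) (cong₂ _+_ p p′) ,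
                             trans (·-⊕ʳ (λ i → + s i) x y) (cong₂ _+_ q q′)

    ∈L-⊛ : ∀ c {x} → InL s x → InL s (c ⊛ x)
    ∈L-⊛ c {x} (p , q) = trans (·-⊛ʳ c 𝟏 x) (trans (cong (c *_) p) (ℤ.*-zeroʳ c)) ,
                     trans (·-⊛ʳ c (λ i → + s i) x) (trans (cong (c *_) q) (ℤ.*-zeroʳ c))

    0∈L : InL s (λ _ → 0ℤ)
    0∈L = sum-zero {n} (λ _ → refl) , sum-zero {n} (λ i → ℤ.*-zeroʳ (+ s i))

    lin-∈L : (z : Fin m → Vector ℤ n) → (∀ i → InL s (z i)) → ∀ c → InL s (lin z c)
    lin-∈L {zero}  z z∈L c = 0∈L
    lin-∈L {suc m} z z∈L c = ∈L-⊕ {c zero ⊛ z zero} {lin (z ∘ suc) (c ∘ suc)}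
        (∈L-⊛ (c zero) {z zero} (z∈L zero)) (lin-∈L (z ∘ suc) (z∈L ∘ suc) (c ∘ suc))

    -- Stands for one coordinate of the isometry. Elements of L carry a membership proof, and
    -- `φ-cong` states that the value does not depend on it.
    record Additive (φ : Σ (Vector ℤ n) (InL s) → ℤ) : Set where
      field
        φ-cong : ∀ {x y} → proj₁ x ≗ proj₁ y → φ x ≡ φ y
        φ-⊕    : ∀ {x y} (x∈L : InL s x) (y∈L : InL s y) → φ (x ⊕ y , ∈L-⊕ {x} {y} x∈L y∈L) ≡
            φ (x , x∈L) + φ (y , y∈L)

      open ≡-Reasoning

      φ-0 : φ ((λ _ → 0ℤ) , 0∈L) ≡ 0ℤ
      φ-0 = begin
        a            ≡⟨ eq a ⟩
        (a + a) - a  ≡⟨ cong (λ b → b - a) (sym (φ-⊕ 0∈L 0∈L)) ⟩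
        φ (_ , ∈L-⊕ {λ _ → 0ℤ} {λ _ → 0ℤ} 0∈L 0∈L) - a ≡⟨ cong (λ b → b - a) (φ-cong (λ _ → refl)) ⟩
        a - a        ≡⟨ ℤ.+-inverseʳ a ⟩
        0ℤ           ∎
        where
        a : ℤ
        a = φ ((λ _ → 0ℤ) , 0∈L)
        eq : ∀ a → a ≡ (a + a) - a
        eq = solve-∀

      private
        φ-⊛ᴺ : ∀ k {x} (x∈L : InL s x) → φ (+ k ⊛ x , ∈L-⊛ (+ k) {x} x∈L) ≡ + k * φ (x , x∈L)
        φ-⊛ᴺ zero {x} x∈L = trans (φ-cong (λ i → ℤ.*-zeroˡ (x i)))
            (trans φ-0 (sym (ℤ.*-zeroˡ (φ (x , x∈L)))))
        φ-⊛ᴺ (suc k) {x} x∈L = begin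
          φ (+[1+ k ] ⊛ x , ∈L-⊛ +[1+ k ] {x} x∈L)
            ≡⟨ φ-cong (λ i → ℤ.suc-* (+ k) (x i)) ⟩
          φ (x ⊕ + k ⊛ x , ∈L-⊕ {x} {+ k ⊛ x} x∈L (∈L-⊛ (+ k) {x} x∈L))
            ≡⟨ φ-⊕ {x} {+ k ⊛ x} x∈L (∈L-⊛ (+ k) {x} x∈L) ⟩
          φ (x , x∈L) + φ (+ k ⊛ x , ∈L-⊛ (+ k) {x} x∈L)
            ≡⟨ cong (λ a → φ (x , x∈L) + a) (φ-⊛ᴺ k {x} x∈L) ⟩
          φ (x , x∈L) + + k * φ (x , x∈L)
            ≡⟨ sym (ℤ.suc-* (+ k) (φ (x , x∈L))) ⟩
          +[1+ k ] * φ (x , x∈L) ∎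

      φ-⊛ : ∀ c {x} (x∈L : InL s x) → φ (c ⊛ x , ∈L-⊛ c {x} x∈L) ≡ c * φ (x , x∈L)
      φ-⊛ (+ k) {x} x∈L = φ-⊛ᴺ k {x} x∈L
      φ-⊛ -[1+ k ] {x} x∈L = begin
        b                          ≡⟨ eq a b ⟩
        (a + b) - a                ≡⟨ cong₂ _-_ a+b≡0 (φ-⊛ᴺ (suc k) {x} x∈L) ⟩
        0ℤ - +[1+ k ] * φ (x , x∈L) ≡⟨ trans (ℤ.+-identityˡ _) (ℤ.neg-distribˡ-* +[1+ k ] (φ (x , x∈L))) ⟩
        -[1+ k ] * φ (x , x∈L)     ∎
        where
        a b : ℤ
        a = φ (+[1+ k ] ⊛ x , ∈L-⊛ +[1+ k ] {x} x∈L)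
        b = φ (-[1+ k ] ⊛ x , ∈L-⊛ -[1+ k ] {x} x∈L)
        eq : ∀ a b → b ≡ (a + b) - a
        eq = solve-∀
        a+b≡0 : a + b ≡ 0ℤ
        a+b≡0 = trans (sym (φ-⊕ {+[1+ k ] ⊛ x} { -[1+ k ] ⊛ x} (∈L-⊛ +[1+ k ] {x} x∈L)
            (∈L-⊛ -[1+ k ] {x} x∈L)))
          (trans (φ-cong (λ i → trans (sym (ℤ.*-distribʳ-+ (x i) +[1+ k ] -[1+ k ]))
            (trans (cong (_* x i) (ℤ.+-inverseʳ +[1+ k ])) (ℤ.*-zeroˡ (x i))))) φ-0)

      φ-lin : (z : Fin m → Vector ℤ n) (z∈L : ∀ i → InL s (z i)) → ∀ c →
              φ (lin z c , lin-∈L z z∈L c) ≡ c · (λ i → φ (z i , z∈L i))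
      φ-lin {zero}  z z∈L c = φ-0
      φ-lin {suc m} z z∈L c = trans
        (φ-⊕ {c zero ⊛ z zero} {lin (z ∘ suc) (c ∘ suc)} (∈L-⊛ (c zero) {z zero} (z∈L zero))
            (lin-∈L (z ∘ suc) (z∈L ∘ suc) (c ∘ suc)))
        (cong₂ _+_ (φ-⊛ (c zero) {z zero} (z∈L zero)) (φ-lin (z ∘ suc) (z∈L ∘ suc) (c ∘ suc)))

    module Generators (spectrum : Spectrum s m) where
      open Spectrum spectrum

      private
        w : Vector ℤ n
        w i = + s i

      -- The i-th unit vector, moved into L by multiples of the unit vectors at the values 1 and 2.
      -- For `x` in L these corrections cancel in the combination with coefficients `x i`, so the
      -- `z i` generate L and no basis has to be chosen.
      z : Fin n → Vector ℤ n
      z i = δ i ⊖ (w i - 1ℤ) ⊛ δ (ι 2) ⊕ (w i - + 2) ⊛ δ (ι 1)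

      private
        ·-z : ∀ u i → u · z i ≡ u i - (w i - 1ℤ) * u (ι 2) + (w i - + 2) * u (ι 1)
        ·-z u i = trans (·-⊕ʳ u (δ i ⊖ (w i - 1ℤ) ⊛ δ (ι 2)) ((w i - + 2) ⊛ δ (ι 1))) (cong₂ _+_
          (trans (·-⊖ʳ u (δ i) ((w i - 1ℤ) ⊛ δ (ι 2))) (cong₂ _-_ (·-δʳ u i)
            (trans (·-⊛ʳ (w i - 1ℤ) u (δ (ι 2))) (cong ((w i - 1ℤ) *_) (·-δʳ u (ι 2))))))
          (trans (·-⊛ʳ (w i - + 2) u (δ (ι 1))) (cong ((w i - + 2) *_) (·-δʳ u (ι 1)))))

      z∈L : ∀ i → InL s (z i)
      z∈L i = trans (·-z 𝟏 i) (eq₁ (w i)) ,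
              trans (·-z w i) (trans (cong₂ (λ a b → w i - (w i - 1ℤ) * a + (w i - + 2) * b)
                  (cong (+_) (s[ι] 2)) (cong (+_) (s[ι] 1))) (eq₂ (w i)))
        where
        eq₁ : ∀ w → 1ℤ - (w - 1ℤ) * 1ℤ + (w - + 2) * 1ℤ ≡ 0ℤ
        eq₁ = solve-∀
        eq₂ : ∀ w → w - (w - 1ℤ) * + 2 + (w - + 2) * + 1 ≡ 0ℤ
        eq₂ = solve-∀

      lin-z : ∀ {x} → InL s x → lin z x ≗ x
      lin-z {x} (𝟏·x≡0 , w·x≡0) k = begin
        x · (λ i → z i k)
          ≡⟨ ·-cong {x = x} {y′ = δ k ⊖ δ (ι 2) k ⊛ (w ⊖ 𝟏) ⊕ δ (ι 1) k ⊛ (w ⊖ + 2 ⊛ 𝟏)} (λ _ → refl)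
               (λ i → cong₂ _+_ (cong₂ _-_ (δ-sym i k) (ℤ.*-comm (w i - 1ℤ) (δ (ι 2) k)))
                   (ℤ.*-comm (w i - + 2) (δ (ι 1) k))) ⟩
        x · (δ k ⊖ δ (ι 2) k ⊛ (w ⊖ 𝟏) ⊕ δ (ι 1) k ⊛ (w ⊖ + 2 ⊛ 𝟏))
          ≡⟨ trans (·-⊕ʳ x (δ k ⊖ δ (ι 2) k ⊛ (w ⊖ 𝟏)) (δ (ι 1) k ⊛ (w ⊖ + 2 ⊛ 𝟏))) (cong₂ _+_
               (trans (·-⊖ʳ x (δ k) (δ (ι 2) k ⊛ (w ⊖ 𝟏))) (cong₂ _-_ (·-δʳ x k)
                 (trans (·-⊛ʳ (δ (ι 2) k) x (w ⊖ 𝟏)) (cong (δ (ι 2) k *_) (·-⊖ʳ x w 𝟏)))))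
               (trans (·-⊛ʳ (δ (ι 1) k) x (w ⊖ + 2 ⊛ 𝟏))
                   (cong (δ (ι 1) k *_) (trans (·-⊖ʳ x w (+ 2 ⊛ 𝟏))
                   (cong (λ a → x · w - a) (·-⊛ʳ (+ 2) x 𝟏)))))) ⟩
        x k - δ (ι 2) k * (x · w - x · 𝟏) + δ (ι 1) k * (x · w - + 2 * (x · 𝟏))
          ≡⟨ cong₂ (λ a b → x k - δ (ι 2) k * (a - b) + δ (ι 1) k * (a - + 2 * b))
               (trans (·-comm x w) w·x≡0) (trans (·-comm x 𝟏) 𝟏·x≡0) ⟩
        x k - δ (ι 2) k * (0ℤ - 0ℤ) + δ (ι 1) k * (0ℤ - + 2 * 0ℤ)
          ≡⟨ eq (x k) (δ (ι 2) k) (δ (ι 1) k) ⟩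
        x k ∎
        where
        open ≡-Reasoning
        eq : ∀ x a b → x - a * (0ℤ - 0ℤ) + b * (0ℤ - + 2 * 0ℤ) ≡ x
        eq = solve-∀

      additive⇒linear : ∀ {φ} → Additive φ → ∀ {x} (x∈L : InL s x) → φ (x , x∈L) ≡
          x · (λ i → φ (z i , z∈L i))
      additive⇒linear additive {x} x∈L = trans (φ-cong (λ k → sym (lin-z {x} x∈L k))) (φ-lin z z∈L x)
        where open Additive additive

  module _ {d k k′ : ℕ} {h : Vector ℕ k} {h′ : Vector ℕ k′} (iso : Isometric (L d h) (L d h′)) where
    private
      s s′ : Vector ℕ (d ℕ.+ 2)
      s  = smallestNonHoles h (d ℕ.+ 2)
      s′ = smallestNonHoles h′ (d ℕ.+ 2)

      member : ∀ {x} → InL s x → IntegerLattice.Member (L d h) x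
      member {x} (p , q) = trans (sym (𝟏·x x)) p , q

      open Isometric iso
      open module GM = GroupMorphisms (AbelianGroup.rawGroup (IntegerLattice.abelianGroup (L d h)))
                          (AbelianGroup.rawGroup (IntegerLattice.abelianGroup (L d h′)))
      open GM.IsGroupIsomorphism isIsomorphism using (⟦⟧-cong; ∙-homo)

      T : Σ (Vector ℤ (d ℕ.+ 2)) (InL s) → Vector ℤ (d ℕ.+ 2)
      T (x , x∈L) = proj₁ (to (x , member {x} x∈L))

      T-additive : ∀ j → Additive {s = s} (λ x → T x j)
      T-additive j = record
        { φ-cong = λ x≗y → ⟦⟧-cong x≗y j
        ; φ-⊕    = λ {x} {y} x∈L y∈L → trans
            (⟦⟧-cong {x ⊕ y , member {x ⊕ y} (∈L-⊕ {s = s} {x} {y} x∈L y∈L)}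
                     {x ⊕ y , IntegerLattice.∙-member (L d h) {x} {y} (member {x} x∈L) (member {y} y∈L)}
                         (λ _ → refl) j)
            (∙-homo (x , member {x} x∈L) (y , member {y} y∈L) j)
        }

    module _ (spectrum : Spectrum s m) where
      private
        open module Gen = Generators {s = s} spectrum using (z; z∈L; additive⇒linear)

        G : Fin (d ℕ.+ 2) → Vector ℤ (d ℕ.+ 2)
        G i = T (z i , z∈L i)

        T≗lin : ∀ {x} (x∈L : InL s x) → T (x , x∈L) ≗ lin G x
        T≗lin {x} x∈L j = additive⇒linear (T-additive j) {x} x∈L

      isometric⇒embedding : Embedding {N = d ℕ.+ 2} s
      isometric⇒embedding = record
        { G        = G
        ; isometry = λ {x} {y} x∈L y∈L → trans
            (sym (·-cong {x = T (x , x∈L)} {y = T (y , y∈L)} (T≗lin {x} x∈L) (T≗lin {y} y∈L)))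
            (preserves-· (x , member {x} x∈L) (y , member {y} y∈L))
        }

      embedding-image : ∀ {x} → InL s x → InL s′ (lin (Embedding.G isometric⇒embedding) x)
      embedding-image {x} x∈L = ∈L-cong {s = s′} {T (x , x∈L)} (T≗lin {x} x∈L)
        (trans (𝟏·x (T (x , x∈L))) (proj₁ (proj₂ (to (x , member {x} x∈L)))) , proj₂
            (proj₂ (to (x , member {x} x∈L))))

open Lattices
open import Data.Nat.Base using (pred; _+_; _∸_; _≤_; _<_)

private variable m n : ℕ

-- Counting and selecting numbers

injection⇒≤ : {k B : ℕ} (g : Fin n ⊎ Fin k → ℕ) → Injective _≡_ _≡_ g →
              (∀ x → 1 ≤ g x) → (∀ x → g x ≤ B) → n + k ≤ B
injection⇒≤ {n} {k} {B} g g-injective 1≤g g≤B = Fin.injective⇒≤ {f = f} f-injective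
  where
  pred-g< : ∀ x → pred (g x) < B
  pred-g< x with g x | 1≤g x | g≤B x
  ... | suc _ | _ | p = p
  f : Fin (n + k) → Fin B
  f i = Fin.fromℕ< (pred-g< (Fin.splitAt n i))
  pred-injective : ∀ {a b} → 1 ≤ a → 1 ≤ b → pred a ≡ pred b → a ≡ b
  pred-injective {suc a} {suc b} _ _ eq = cong suc eq
  f-injective : Injective _≡_ _≡_ f
  f-injective {i} {j} eq = trans (sym (Fin.join-splitAt n k i)) (trans
    (cong (Fin.join n k) (g-injective
        (pred-injective (1≤g (Fin.splitAt n i)) (1≤g (Fin.splitAt n j))
        (trans (sym (Fin.toℕ-fromℕ< (pred-g< (Fin.splitAt n i))))
      (trans (cong Fin.toℕ eq) (Fin.toℕ-fromℕ< (pred-g< (Fin.splitAt n j))))))))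
    (Fin.join-splitAt n k j))

join-injective : ∀ n k → Injective _≡_ _≡_ (Fin.join n k)
join-injective n k {x} {y} eq =
    trans (sym (Fin.splitAt-join n k x)) (trans (cong (Fin.splitAt n) eq) (Fin.splitAt-join n k y))

at-most-one : {P : Fin 4 → Set} → Decidable P → (∀ {i j} → i Fin.< j → P i → ¬ P j) →
              ∃ λ x → ∀ i → i ≢ x → ¬ P i
at-most-one P? unique with Fin.any? P?
... | no none = zero , λ i _ Pi → none (i , Pi)
... | yes (x , Px) = x , λ i i≢x Pi → others i i≢x Pi (Fin.<-cmp i x)
  where
  others : ∀ i → i ≢ x → _ → Tri (i Fin.< x) (i ≡ x) (x Fin.< i) → _
  others i i≢x Pi (tri< i<x _ _) = unique i<x Pi Px
  others i i≢x Pi (tri≈ _ i≡x _) = i≢x i≡x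
  others i i≢x Pi (tri> _ _ x<i) = unique x<i Px Pi

opaque
  two-of-four : ∀ (x y : Fin 4) → ∃ λ i → ∃ λ j → i Fin.< j × (i ≢ x × i ≢ y) × (j ≢ x × j ≢ y)
  two-of-four = from-yes dec
    where
    dec : Dec (∀ (x y : Fin 4) → ∃ λ i → ∃ λ j → i Fin.< j × (i ≢ x × i ≢ y) × (j ≢ x × j ≢ y))
    dec = Fin.all? λ x → Fin.all? λ y → Fin.any? λ i → Fin.any? λ j →
      i Fin.<? j ×-dec (¬? (i Fin.≟ x) ×-dec ¬? (i Fin.≟ y)) ×-dec (¬? (j Fin.≟ x) ×-dec ¬? (j Fin.≟ y))

  three-of-four : ∀ (y : Fin 4) → ∃ λ i → ∃ λ j → ∃ λ k → i Fin.< j × j Fin.< k × i ≢ y × j ≢ y × k ≢ y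
  three-of-four = from-yes dec
    where
    dec : Dec (∀ (y : Fin 4) → ∃ λ i → ∃ λ j → ∃ λ k → i Fin.< j × j Fin.< k × i ≢ y × j ≢ y × k ≢ y)
    dec = Fin.all? λ y → Fin.any? λ i → Fin.any? λ j → Fin.any? λ k →
      i Fin.<? j ×-dec j Fin.<? k ×-dec ¬? (i Fin.≟ y) ×-dec ¬? (j Fin.≟ y) ×-dec ¬? (k Fin.≟ y)

-- The bound `B` lets a selection grow upwards: every new number is at least `B`, hence different
-- from all earlier ones.
record Selection (P : ℕ → Set) (m B : ℕ) : Set where
  field
    α         : Fin m → ℕ
    injective : Injective _≡_ _≡_ α
    positive  : ∀ i → 1 ≤ α i
    α<B       : ∀ i → α i < B
    satisfies : ∀ i → P (α i)

select-none : {P : ℕ → Set} → Selection P 0 1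
select-none = record { α = λ () ; injective = λ {} ; positive = λ () ; α<B = λ () ; satisfies = λ () }

select-cons : ∀ {P B B′ v} → 1 ≤ v → B ≤ v → v < B′ → P v → Selection P m B → Selection P (suc m) B′
select-cons {m} {P} {B} {B′} {v} 1≤v B≤v v<B′ Pv S = record
  { α         = α′
  ; injective = λ {i} {j} → inj i j
  ; positive  = λ { zero → 1≤v ; (suc i) → positive i }
  ; α<B       = λ { zero → v<B′ ; (suc i) → ℕ.<-trans (ℕ.<-≤-trans (α<B i) B≤v) v<B′ }
  ; satisfies = λ { zero → Pv ; (suc i) → satisfies i }
  }
  where
  open Selection S
  α′ : Fin (suc m) → ℕ
  α′ = v ∷ α
  α≢v : ∀ i → α i ≢ v
  α≢v i = ℕ.<⇒≢ (ℕ.<-≤-trans (α<B i) B≤v)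
  inj : ∀ i j → α′ i ≡ α′ j → i ≡ j
  inj zero    zero    _  = refl
  inj zero    (suc j) eq = contradiction (sym eq) (α≢v j)
  inj (suc i) zero    eq = contradiction eq (α≢v i)
  inj (suc i) (suc j) eq = cong suc (injective eq)

-- The non-holes of a spaced hole sequence

module HoleSequence {d : ℕ} (46≤d : 46 ≤ d) {n : ℕ} {h : Vector ℕ (suc n)}
    (isHoleSequence : IsHoleSequence h)
  (7≤h : 7 ≤ h zero) (h-last : h (fromℕ n) ≡ d + suc n + 1)
  (h-gap : ∀ (i : Fin n) → h (inject₁ i) + 4 ≤ h (suc i)) where

  private
    module H = IsHoleSequence isHoleSequence

  N : ℕ
  N = d + suc n + 2

  s : Vector ℕ (d + 2)
  s = smallestNonHoles h (d + 2)

  private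
    module S = AreSmallestNonHoles (areSmallestNonHoles h (d + 2))

    h-mono : ∀ {i j} → i Fin.≤ j → h i ≤ h j
    h-mono {i} {j} i≤j with Fin.<-cmp i j
    ... | tri< i<j _ _ = ℕ.<⇒≤ (H.strictlyIncreasing i j i<j)
    ... | tri≈ _ refl _ = ℕ.≤-refl
    ... | tri> _ _ j<i = contradiction j<i (ℕ.≤⇒≯ i≤j)

    h-spaced : ∀ {i j} → i Fin.< j → h i + 4 ≤ h j
    h-spaced {i} {suc j} (s≤s i≤j) = ℕ.≤-trans
      (ℕ.+-monoˡ-≤ 4 (h-mono (subst (Fin.toℕ i ≤_) (sym (Fin.toℕ-inject₁ j)) i≤j))) (h-gap j)

    1+[N-1]≡N : suc (d + suc n + 1) ≡ N
    1+[N-1]≡N = sym (ℕ.+-suc (d + suc n) 1)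

    49≤N : 49 ≤ N
    49≤N = ℕ.+-monoˡ-≤ 2 (ℕ.+-mono-≤ 46≤d (s≤s {0} {n} z≤n))

  hole<N : ∀ {v} → IsHole h v → v < N
  hole<N (i , refl) = subst (h i <_) 1+[N-1]≡N (s≤s (subst (h i ≤_) h-last (h-mono (Fin.≤fromℕ i))))

  7≤hole : ∀ {v} → IsHole h v → 7 ≤ v
  7≤hole (i , refl) = ℕ.≤-trans 7≤h (h-mono {zero} {i} z≤n)

  holes-spaced : ∀ {u v} → IsHole h u → IsHole h v → u < v → u + 4 ≤ v
  holes-spaced (i , refl) (j , refl) hi<hj with Fin.<-cmp i j
  ... | tri< i<j _ _ = h-spaced i<j
  ... | tri≈ _ refl _ = contradiction hi<hj (ℕ.<-irrefl refl)
  ... | tri> _ _ j<i = contradiction hi<hj (ℕ.<-asym (H.strictlyIncreasing j i j<i))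

  no-close-holes : ∀ {u v} → IsHole h u → u < v → v ≤ u + 3 → ¬ IsHole h v
  no-close-holes {u} {v} hu u<v v≤u+3 hv =
      ℕ.<⇒≱ (ℕ.+-monoʳ-< u {3} {4} ℕ.≤-refl) (ℕ.≤-trans (holes-spaced hu hv u<v) v≤u+3)

  s-increasing : Increasing s
  s-increasing {i} {j} = S.strictlyIncreasing i j

  s-injective : Injective _≡_ _≡_ s
  s-injective {i} {j} eq with Fin.<-cmp i j
  ... | tri< i<j _ _ = contradiction eq (ℕ.<⇒≢ (s-increasing i<j))
  ... | tri≈ _ i≡j _ = i≡j
  ... | tri> _ _ j<i = contradiction (sym eq) (ℕ.<⇒≢ (s-increasing j<i))

  private
    d+1<d+2 : d + 1 < d + 2
    d+1<d+2 = ℕ.+-monoʳ-< d ℕ.≤-refl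

  top : Fin (d + 2)
  top = Fin.fromℕ< d+1<d+2

  toℕ-top : suc (Fin.toℕ top) ≡ d + 2
  toℕ-top = trans (cong suc (Fin.toℕ-fromℕ< d+1<d+2)) (sym (ℕ.+-suc d 1))

  private
    ≤top : ∀ i → i Fin.≤ top
    ≤top i = ℕ.≤-pred (subst (suc (Fin.toℕ i) ≤_) (sym toℕ-top) (Fin.toℕ<n i))

    s≤s-top : ∀ i → s i ≤ s top
    s≤s-top i with Fin.<-cmp i top
    ... | tri< i<t _ _ = ℕ.<⇒≤ (s-increasing i<t)
    ... | tri≈ _ refl _ = ℕ.≤-refl
    ... | tri> _ _ t<i = contradiction t<i (ℕ.≤⇒≯ (≤top i))

    values : Fin (d + 2) ⊎ Fin (suc n) → ℕ
    values (inj₁ i) = s i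
    values (inj₂ i) = h i

    values-injective : Injective _≡_ _≡_ values
    values-injective {inj₁ i} {inj₁ j} eq = cong inj₁ (s-injective eq)
    values-injective {inj₁ i} {inj₂ j} eq = contradiction (j , sym eq) (S.nonHoles i)
    values-injective {inj₂ i} {inj₁ j} eq = contradiction (i , eq) (S.nonHoles j)
    values-injective {inj₂ i} {inj₂ j} eq with Fin.<-cmp i j
    ... | tri< i<j _ _ = contradiction eq (ℕ.<⇒≢ (H.strictlyIncreasing i j i<j))
    ... | tri≈ _ i≡j _ = cong inj₂ i≡j
    ... | tri> _ _ j<i = contradiction (sym eq) (ℕ.<⇒≢ (H.strictlyIncreasing j i j<i))

    total : d + 2 + suc n ≡ N
    total = trans (ℕ.+-assoc d 2 (suc n))
        (trans (cong (d +_) (ℕ.+-comm 2 (suc n))) (sym (ℕ.+-assoc d (suc n) 2)))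

    -- Otherwise all non-holes in the list and all holes would be distinct numbers up to `N - 1`,
    -- but together there are `N` of them.
    N≤s-top : N ≤ s top
    N≤s-top = ℕ.≮⇒≥ λ s-top<N → ℕ.<⇒≱ (ℕ.≤-reflexive 1+[N-1]≡N) (subst (_≤ d + suc n + 1) total
      (injection⇒≤ values values-injective
        (λ { (inj₁ i) → S.positive i ; (inj₂ i) → H.positive i })
        (λ { (inj₁ i) → ℕ.≤-trans (s≤s-top i) (ℕ.≤-pred (subst (s top <_) (sym 1+[N-1]≡N) s-top<N))
           ; (inj₂ i) → ℕ.≤-pred (subst (h i <_) (sym 1+[N-1]≡N) (hole<N (i , refl))) })))

  occurs : ∀ v → 1 ≤ v → v ≤ N → ¬ IsHole h v → ∃ λ j → s j ≡ v
  occurs v 1≤v v≤N ¬hole = S.smallest top v 1≤v ¬hole (ℕ.≤-trans v≤N N≤s-top)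

  -- If the largest listed non-hole exceeded `N`, each of 1, ..., `N` would be a hole or one of the
  -- `d + 1` earlier non-holes, which is one slot too few.
  s-top≡N : s top ≡ N
  s-top≡N = ℕ.≤-antisym (ℕ.≮⇒≥ λ N<s-top →
      ℕ.<⇒≱ (ℕ.≤-reflexive 1+≡N) (Fin.injective⇒≤ (classify-injective N<s-top))) N≤s-top
    where
    1+≡N : suc (d + 1 + suc n) ≡ N
    1+≡N = trans (cong (_+ suc n) (sym (ℕ.+-suc d 1))) total
    module _ (N<s-top : N < s top) where
      value : Fin N → ℕ
      value = suc ∘ Fin.toℕ
      locate : ∀ x → Dec (IsHole h (value x)) → Σ (Fin (d + 1) ⊎ Fin (suc n)) λ where
        (inj₁ j) → nonHole h (Fin.toℕ j) ≡ value x
        (inj₂ i) → h i ≡ value x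
      locate x (yes (i , eq)) = inj₂ i , eq
      locate x (no ¬hole) = let j , eq = occurs (value x) (s≤s z≤n) (Fin.toℕ<n x) ¬hole
                                j<t : j Fin.< top
                                j<t = increasing-reflects s-increasing (subst (_< s top) (sym eq) (ℕ.≤-<-trans (Fin.toℕ<n x) N<s-top))
                                j<d+1 : Fin.toℕ j < d + 1
                                j<d+1 = subst (Fin.toℕ j <_) (Fin.toℕ-fromℕ< d+1<d+2) j<t
                            in inj₁ (Fin.fromℕ< j<d+1) , trans (cong (nonHole h) (Fin.toℕ-fromℕ< j<d+1)) eq
      located : ∀ x → _
      located x = locate x (isHole? h (value x))
      classify : Fin N → Fin (d + 1 + suc n)
      classify x = Fin.join (d + 1) (suc n) (proj₁ (located x))
      same-value : ∀ {x y} → (p : proj₁ (located x) ≡ proj₁ (located y)) → value x ≡ value y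
      same-value {x} {y} p with located x | located y
      same-value refl | inj₁ j , eq | inj₁ j , eq′ = trans (sym eq) eq′
      same-value refl | inj₂ i , eq | inj₂ i , eq′ = trans (sym eq) eq′
      classify-injective : Injective _≡_ _≡_ classify
      classify-injective {x} {y} eq =
          Fin.toℕ-injective (ℕ.suc-injective (same-value {x} {y} (join-injective (d + 1) (suc n) eq)))

  private
    -- The last hole is `N - 1`, so by the spacing `N - 2` is not a hole. This is the gap 2 at the
    -- end of `s`.
    below-top : ∃ λ j → s j ≡ d + suc n
    below-top = occurs (d + suc n) (ℕ.m≤n⇒m≤o+n d (s≤s z≤n)) (ℕ.m≤m+n (d + suc n) 2)
      (λ hole → no-close-holes hole (ℕ.m<m+n (d + suc n) (s≤s z≤n)) (ℕ.+-monoʳ-≤ (d + suc n) (s≤s z≤n))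
          (fromℕ n , h-last))

  top⁻ : Fin (d + 2)
  top⁻ = proj₁ below-top

  s-top-gap : s top ≡ 2 + s top⁻
  s-top-gap = trans s-top≡N (trans (ℕ.+-comm (d + suc n) 2) (cong (2 +_) (sym (proj₂ below-top))))

  toℕ-top⁻ : suc (suc (Fin.toℕ top⁻)) ≡ d + 2
  toℕ-top⁻ = trans (cong suc adjacent) toℕ-top
    where
    top⁻<top : top⁻ Fin.< top
    top⁻<top = increasing-reflects s-increasing
        (subst (s top⁻ <_) (sym s-top-gap) (ℕ.m≤n+m (suc (s top⁻)) 1))
    adjacent : suc (Fin.toℕ top⁻) ≡ Fin.toℕ top
    adjacent = ℕ.≤-antisym top⁻<top (ℕ.≮⇒≥ between)
      where
      between : ¬ (suc (Fin.toℕ top⁻) < Fin.toℕ top)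
      between lt = S.nonHoles x (fromℕ n , trans h-last (ℕ.≤-antisym x≥ x≤))
        where
        x< : suc (Fin.toℕ top⁻) < d + 2
        x< = ℕ.<-trans lt (Fin.toℕ<n top)
        x : Fin (d + 2)
        x = Fin.fromℕ< x<
        x≥ : d + suc n + 1 ≤ s x
        x≥ = subst (_≤ s x) (trans (cong suc (proj₂ below-top)) (sym (ℕ.+-comm (d + suc n) 1)))
          (s-increasing (subst (suc (Fin.toℕ top⁻) ≤_) (sym (Fin.toℕ-fromℕ< x<)) ℕ.≤-refl))
        x≤ : s x ≤ d + suc n + 1
        x≤ = ℕ.≤-pred (subst (s x <_) (trans s-top≡N (sym 1+[N-1]≡N))
          (s-increasing (subst (_< Fin.toℕ top) (sym (Fin.toℕ-fromℕ< x<)) lt)))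

  private
    Good : ℕ → ℕ → Set
    Good σ v = ¬ IsHole h v × ¬ IsHole h (σ ∸ v)

    module _ (σ : ℕ) (49≤σ : 49 ≤ σ) (σ≤50 : σ ≤ 50) where

      close : ∀ b {i j : Fin 4} → i Fin.< j → b + Fin.toℕ j ≤ b + Fin.toℕ i + 3
      close b {i} {j} i<j = subst (b + Fin.toℕ j ≤_) (sym (ℕ.+-assoc b (Fin.toℕ i) 3))
        (ℕ.+-monoʳ-≤ b (ℕ.≤-trans (ℕ.≤-pred (Fin.toℕ<n j)) (ℕ.m≤n+m 3 (Fin.toℕ i))))

      holes-in-block : ∀ b → ∃ λ x → ∀ i → i ≢ x → ¬ IsHole h (b + Fin.toℕ {4} i)
      holes-in-block b = at-most-one (λ i → isHole? h (b + Fin.toℕ i))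
        (λ {i} {j} i<j hi → no-close-holes hi (ℕ.+-monoʳ-< b i<j) (close b i<j))

      reflected-holes-in-block : ∀ b → b + 3 ≤ σ → ∃ λ x → ∀ i → i ≢ x →
          ¬ IsHole h (σ ∸ (b + Fin.toℕ {4} i))
      reflected-holes-in-block b b+3≤σ = at-most-one (λ i → isHole? h (σ ∸ (b + Fin.toℕ i)))
        (λ {i} {j} i<j hi hj → no-close-holes hj (ℕ.∸-monoʳ-< (ℕ.+-monoʳ-< b i<j) (in-range j))
            (bound i<j) hi)
        where
        in-range : ∀ (j : Fin 4) → b + Fin.toℕ j ≤ σ
        in-range j = ℕ.≤-trans (ℕ.+-monoʳ-≤ b (ℕ.≤-pred (Fin.toℕ<n j))) b+3≤σ
        bound : ∀ {i j : Fin 4} → i Fin.< j → σ ∸ (b + Fin.toℕ i) ≤ σ ∸ (b + Fin.toℕ j) + 3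
        bound {i} {j} i<j = ℕ.m≤n+o⇒m∸n≤o σ (b + Fin.toℕ i) (begin
          σ                                                          ≡⟨ sym (ℕ.m∸n+n≡m (in-range j)) ⟩
          σ ∸ (b + Fin.toℕ j) + (b + Fin.toℕ j)                      ≤⟨ ℕ.+-monoʳ-≤ (σ ∸ (b + Fin.toℕ j))
              (close b i<j) ⟩
          σ ∸ (b + Fin.toℕ j) + (b + Fin.toℕ i + 3)                  ≡⟨ ℕ.+-comm (σ ∸ (b + Fin.toℕ j))
              (b + Fin.toℕ i + 3) ⟩
          b + Fin.toℕ i + 3 + (σ ∸ (b + Fin.toℕ j))                  ≡⟨ ℕ.+-assoc (b + Fin.toℕ i) 3
              (σ ∸ (b + Fin.toℕ j)) ⟩
          b + Fin.toℕ i + (3 + (σ ∸ (b + Fin.toℕ j)))                ≡⟨ cong (b + Fin.toℕ i +_)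
              (ℕ.+-comm 3 (σ ∸ (b + Fin.toℕ j))) ⟩
          b + Fin.toℕ i + (σ ∸ (b + Fin.toℕ j) + 3)                  ∎)
          where open ℕ.≤-Reasoning

      -- The numbers 1 to 4 are below every hole, so only the reflection can spoil one of them.
      first-block : Selection (Good σ) 3 5
      first-block =
        let y , ok = reflected-holes-in-block 1 (ℕ.≤-trans (from-yes (4 ℕ.≤? 49)) 49≤σ)
            i , j , k , i<j , j<k , i≢y , j≢y , k≢y = three-of-four y
        in select-cons (s≤s z≤n) (s≤s j<k) (s≤s (Fin.toℕ<n k)) (low k , ok k k≢y)
          (select-cons (s≤s z≤n) (s≤s i<j) ℕ.≤-refl (low j , ok j j≢y)
          (select-cons (s≤s z≤n) (s≤s z≤n) ℕ.≤-refl (low i , ok i i≢y) select-none))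
        where
        low : ∀ (i : Fin 4) → ¬ IsHole h (1 + Fin.toℕ i)
        low i hole = ℕ.<⇒≱ (ℕ.≤-trans (s≤s (Fin.toℕ<n i)) (from-yes (5 ℕ.≤? 7))) (7≤hole hole)

      -- Holes, and likewise reflected holes, are at least 4 apart, so four consecutive numbers lose
      -- at most one to each kind.
      next-block : ∀ {m} b → b + 3 ≤ 24 → Selection (Good σ) m (suc b) →
          Selection (Good σ) (2 + m) (suc b + 4)
      next-block b b+3≤24 S =
        let x , ok-x = holes-in-block (suc b)
            y , ok-y = reflected-holes-in-block (suc b)
                (ℕ.≤-trans (s≤s b+3≤24) (ℕ.≤-trans (from-yes (25 ℕ.≤? 49)) 49≤σ))
            i , j , i<j , (i≢x , i≢y) , (j≢x , j≢y) = two-of-four x y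
        in select-cons (s≤s z≤n) (ℕ.+-monoʳ-< (suc b) i<j) (ℕ.+-monoʳ-< (suc b) (Fin.toℕ<n j))
            (ok-x j j≢x , ok-y j j≢y)
          (select-cons (s≤s z≤n) (ℕ.m≤m+n (suc b) (Fin.toℕ i)) ℕ.≤-refl (ok-x i i≢x , ok-y i i≢y) S)

      selection : Selection (Good σ) 13 25
      selection =
        next-block 20 (from-yes (23 ℕ.≤? 24))
            (next-block 16 (from-yes (19 ℕ.≤? 24)) (next-block 12 (from-yes (15 ℕ.≤? 24))
        (next-block 8 (from-yes (11 ℕ.≤? 24)) (next-block 4 (from-yes (7 ℕ.≤? 24)) first-block))))

      pairs : Pairs s 13 σ
      pairs = record
        { a         = λ i → proj₁ (at-a i)
        ; b         = λ i → proj₁ (at-b i)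
        ; injective = λ {i} {j} eq → injective
            (trans (sym (proj₂ (at-a i))) (trans (cong s eq) (proj₂ (at-a j))))
        ; a≤24      = λ i → subst (_≤ 24) (sym (proj₂ (at-a i))) (α≤24 i)
        ; 25≤b      = λ i → subst (25 ≤_) (sym (proj₂ (at-b i))) (25≤σ-α i)
        ; s[a]+s[b] = λ i → trans (cong₂ _+_ (proj₂ (at-a i)) (proj₂ (at-b i))) (ℕ.m+[n∸m]≡n (α≤σ i))
        }
        where
        open Selection selection
        α≤24 : ∀ i → α i ≤ 24
        α≤24 i = ℕ.≤-pred (α<B i)
        α≤σ : ∀ i → α i ≤ σ
        α≤σ i = ℕ.≤-trans (α≤24 i) (ℕ.≤-trans (from-yes (24 ℕ.≤? 49)) 49≤σ)
        25≤σ-α : ∀ i → 25 ≤ σ ∸ α i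
        25≤σ-α i = ℕ.∸-mono 49≤σ (α≤24 i)
        at-a : ∀ i → ∃ λ j → s j ≡ α i
        at-a i = occurs (α i) (positive i) (ℕ.≤-trans (α≤24 i) (ℕ.≤-trans (from-yes (24 ℕ.≤? 49)) 49≤N))
            (proj₁ (satisfies i))
        -- The partner is at most 50 - 1 = 49, and `49≤N` is where `46 ≤ d` enters.
        at-b : ∀ i → ∃ λ j → s j ≡ σ ∸ α i
        at-b i = occurs (σ ∸ α i) (ℕ.≤-trans (s≤s z≤n) (25≤σ-α i))
            (ℕ.≤-trans (ℕ.∸-mono σ≤50 (positive i)) 49≤N) (proj₂ (satisfies i))

  spectrum : Spectrum s 13
  spectrum = record
    { injective = s-injective
    ; positive  = S.positive
    ; small     = λ v 1≤v v≤6 → occurs v 1≤v (ℕ.≤-trans v≤6 (ℕ.≤-trans (from-yes (6 ℕ.≤? 49)) 49≤N))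
                    (λ hole → ℕ.<⇒≱ (s≤s v≤6) (7≤hole hole))
    ; dense     = λ j → dense j (s j) refl
    ; pairs₄₉   = pairs 49 ℕ.≤-refl (from-yes (49 ℕ.≤? 50))
    ; pairs₅₀   = pairs 50 (from-yes (49 ℕ.≤? 50)) ℕ.≤-refl
    }
    where
    -- Of the two numbers below `v` at most one is a hole, and every smaller positive non-hole is
    -- again a value of `s`.
    dense : ∀ j v → s j ≡ v → 7 ≤ v → ∃ λ y → 1 + s y ≡ v ⊎ 2 + s y ≡ v
    dense j (suc (suc v)) sj≡v (s≤s (s≤s 5≤v)) with isHole? h (suc v)
    ... | no ¬hole = let y , eq = S.smallest j (suc v) (s≤s z≤n) ¬hole (subst (suc v ≤_) (sym sj≡v) (ℕ.n≤1+n (suc v)))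
                     in y , inj₁ (cong suc eq)
    ... | yes hole = let y , eq = S.smallest j v (ℕ.≤-trans (s≤s z≤n) 5≤v)
                                    (λ hole′ → no-close-holes hole′ (ℕ.n<1+n v)
                                        (subst (suc v ≤_) (ℕ.+-comm 3 v) (ℕ.m≤n+m (suc v) 2)) hole)
                                    (subst (v ≤_) (sym sj≡v) (ℕ.m≤n+m v 2))
                     in y , inj₂ (cong (2 +_) eq)

-- Equal hole sequences give isometric lattices

module _ {k : ℕ} {h h′ : Vector ℕ k} (h≗h′ : h ≗ h′) where

  skipHoles-cong : ∀ f m → skipHoles h f m ≡ skipHoles h′ f m
  skipHoles-cong zero m = refl
  skipHoles-cong (suc f) m with isHole? h m | isHole? h′ m
  ... | yes _       | yes _       = skipHoles-cong f (suc m)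
  ... | no _        | no _        = refl
  ... | yes (i , p) | no ¬hole    = contradiction (i , trans (sym (h≗h′ i)) p) ¬hole
  ... | no ¬hole    | yes (i , p) = contradiction (i , trans (h≗h′ i) p) ¬hole

  nonHole-cong : ∀ i → nonHole h i ≡ nonHole h′ i
  nonHole-cong zero    = skipHoles-cong k 1
  nonHole-cong (suc i) = trans (cong (nextNonHole h ∘ suc) (nonHole-cong i))
      (skipHoles-cong k (suc (nonHole h′ i)))

≗⇒isometric : ∀ d {k} {h h′ : Vector ℕ k} → h ≗ h′ → Isometric (L d h) (L d h′)
≗⇒isometric d {h = h} {h′} h≗h′ = record
  { to            = λ (x , x∈L) → x , transport h≗h′ x∈L
  ; isIsomorphism = record
    { isGroupMonomorphism = record
      { isGroupHomomorphism = record
        { isMonoidHomomorphism = record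
          { isMagmaHomomorphism = record
            { isRelHomomorphism = record { cong = λ eq → eq }
            ; homo = λ _ _ _ → refl
            }
          ; ε-homo = λ _ → refl
          }
        ; ⁻¹-homo = λ _ _ → refl
        }
      ; injective = λ eq → eq
      }
    ; surjective = λ (y , y∈L) → (y , transport (sym ∘ h≗h′) y∈L) , λ eq → eq
    }
  ; preserves-·   = λ _ _ → refl
  }
  where
  transport : ∀ {h h′ : Vector ℕ _} → h ≗ h′ → ∀ {x} → IntegerLattice.Member (L d h) x →
      IntegerLattice.Member (L d h′) x
  transport h≗h′ {x} (p , q) = p ,
    trans (ℤ-Sum.sum-cong-≗ (λ i → cong (λ v → ℤ.+ v ℤ.* x i) (sym (nonHole-cong h≗h′ (Fin.toℕ i))))) q

theorem3p2 : ∀ (d : ℕ) → 46 ≤ d →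
    ∀ {n n′ : ℕ} (h : Vector ℕ (suc n)) (h′ : Vector ℕ (suc n′)) →
    IsHoleSequence h → IsHoleSequence h′ →
    7 ≤ h zero → 7 ≤ h′ zero →
    h (fromℕ n) ≡ d + suc n + 1 → h′ (fromℕ n′) ≡ d + suc n′ + 1 →
    (∀ (i : Fin n) → h (inject₁ i) + 4 ≤ h (suc i)) →
    (∀ (i : Fin n′) → h′ (inject₁ i) + 4 ≤ h′ (suc i)) →
    Isometric (L d h) (L d h′) ⇔
    (Σ (suc n ≡ suc n′) λ k≡k′ → ∀ i → h i ≡ h′ (cast k≡k′ i))
theorem3p2 d 46≤d {n} {n′} h h′ seq seq′ 7≤h 7≤h′ last last′ gap gap′ =
  mk⇔ (λ iso → holes≡ (lengths≡ iso) (s≗s′ iso)) isometric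
  where
  module H  = HoleSequence 46≤d {n} {h} seq 7≤h last gap
  module H′ = HoleSequence 46≤d {n′} {h′} seq′ 7≤h′ last′ gap′

  s≗s′ : Isometric (L d h) (L d h′) → H.s ≗ H′.s
  s≗s′ iso = isometry⇒≗ H.s-increasing H′.s-increasing H.spectrum H′.spectrum
      H.toℕ-top H.toℕ-top⁻ H.s-top-gap E orth (λ {x} → image {x})
    where
    embedding : Embedding {N = d + 2} H.s
    embedding = isometric⇒embedding iso H.spectrum
    extension : ∃ λ E → Orthogonal 1ℤ E × (∀ {x} → InL H.s x → lin (Embedding.G embedding) x ≗ lin E x)
    extension = orthonormal-extension
        (ℕ.≤-trans (from-yes (5 ℕ.≤? 46)) (ℕ.≤-trans 46≤d (ℕ.m≤m+n d 2))) refl H.spectrum embedding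
    E : Fin (d + 2) → Vector ℤ (d + 2)
    E = proj₁ extension
    orth : Orthogonal 1ℤ E
    orth = proj₁ (proj₂ extension)
    image : ∀ {x} → InL H.s x → InL H′.s (lin E x)
    image {x} x∈L = ∈L-cong {s = H′.s} {lin (Embedding.G embedding) x} {lin E x}
        (proj₂ (proj₂ extension) {x} x∈L)
      (embedding-image iso H.spectrum {x} x∈L)

  -- The largest entry of `s` is `d` plus the number of holes plus 2, so it determines that number.
  lengths≡ : Isometric (L d h) (L d h′) → suc n ≡ suc n′
  lengths≡ iso = ℕ.+-cancelˡ-≡ d _ _ (ℕ.+-cancelʳ-≡ 2 _ _
    (trans (sym H.s-top≡N) (trans (s≗s′ iso H.top) H′.s-top≡N)))

  holes≡ : (k≡k′ : suc n ≡ suc n′) → H.s ≗ H′.s → Σ (suc n ≡ suc n′) λ k≡k′ → ∀ i → h i ≡ h′ (cast k≡k′ i)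
  holes≡ refl s≗s′ = refl , λ i → trans (sym (proj₂ (hole i)))
      (cong h′ (trans (increasing⇒id φ φ-increasing i) (sym (Fin.cast-is-id refl i))))
    where
    -- A hole of `h` that is not a hole of `h′` would occur in `H′.s`, which equals `H.s` and avoids
    -- the holes of `h`. The resulting map between indices is increasing, hence the identity.
    hole : ∀ i → IsHole h′ (h i)
    hole i with isHole? h′ (h i)
    ... | yes p = p
    ... | no ¬hole = let j , eq = H′.occurs (h i) (IsHoleSequence.positive seq i) (ℕ.<⇒≤ (H.hole<N (i , refl))) ¬hole
                     in contradiction (i , sym (trans (s≗s′ j) eq))
                         (AreSmallestNonHoles.nonHoles (areSmallestNonHoles h (d + 2)) j)
    φ : Fin (suc n) → Fin (suc n)
    φ i = proj₁ (hole i)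
    φ-increasing : Increasing (Fin.toℕ ∘ φ)
    φ-increasing {i} {j} i<j = increasing-reflects {s = h′}
        (λ {i} {j} → IsHoleSequence.strictlyIncreasing seq′ i j)
      (subst₂ _<_ (sym (proj₂ (hole i))) (sym (proj₂ (hole j)))
          (IsHoleSequence.strictlyIncreasing seq i j i<j))

  isometric : (Σ (suc n ≡ suc n′) λ k≡k′ → ∀ i → h i ≡ h′ (cast k≡k′ i)) → Isometric (L d h) (L d h′)
  isometric (refl , h≡h′) = ≗⇒isometric d (λ i → trans (h≡h′ i) (cong h′ (Fin.cast-is-id refl i)))
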